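{- Let $A$ be an independent set in the graph $G(n,4,1)$ with $d(A)\le \frac{(tn)^2}{2}$ for some $t\in(0,1)$. Then $$|A|\le (1+o(1))\max\left(\frac{n^2}{8},\frac{tn^2}{2}\right)\quad (n\to\infty).$$
   Context: $G(n,4,1)$ is the graph whose vertex set is the family of all $4$-element subsets of $[n]=\{1,\dots,n\}$, two vertices being adjacent iff they intersect in exactly one element. For distinct $x,y\in[n]$, $S_{xy}$ denotes the family of all $4$-element subsets of $[n]$ containing both $x$ and $y$, and $d(A)=\max_{x\neq y}|S_{xy}\cap A|$.
   Formalization: The parameter t in (0,1), and the epsilon that expresses the o(1) for each fixed t, range over rational numbers instead of real numbers. -}

module Defs where

open import Data.Nat using (ℕ; _⊔_)
open import Data.Fin using (Fin; _≟_)
open import Data.Fin.Subset using (Subset; _∈_; _∩_; ∣_∣)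
open import Data.Fin.Subset.Properties using (_∈?_)
open import Data.List using (List; []; _∷_; length; filter; concatMap; foldr; allFin)
open import Data.List.Membership.Propositional using () renaming (_∈_ to _∈ˡ_)
open import Data.List.Relation.Unary.Unique.Propositional using (Unique)
open import Data.List.Relation.Unary.All using (All)
open import Data.Product using (_×_)
open import Relation.Nullary using (¬_; yes; no)
open import Relation.Nullary.Decidable using (_×-dec_)
open import Relation.Binary.PropositionalEquality using (_≡_)
open import Data.Integer using (+_)
open import Data.Rational using (ℚ; _/_)

IsVertex : ∀ {n} → Subset n → Set
IsVertex a = ∣ a ∣ ≡ 4

Adjacent : ∀ {n} → Subset n → Subset n → Set
Adjacent a b = ∣ a ∩ b ∣ ≡ 1

IsIndependentSet : ∀ {n} → List (Subset n) → Set
IsIndependentSet A =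
  Unique A × All IsVertex A × (∀ {a b} → a ∈ˡ A → b ∈ˡ A → ¬ Adjacent a b)

pairCount : ∀ {n} → List (Subset n) → Fin n → Fin n → ℕ
pairCount A x y = length (filter (λ a → (x ∈? a) ×-dec (y ∈? a)) A)

d : ∀ {n} → List (Subset n) → ℕ
d {n} A = foldr _⊔_ 0
  (concatMap (λ x → concatMap (λ y → pairValue x y) (allFin n)) (allFin n))
  where
  pairValue : Fin n → Fin n → List ℕ
  pairValue x y with x ≟ y
  ... | yes _ = []
  ... | no _  = pairCount A x y ∷ []

ℕtoℚ : ℕ → ℚ
ℕtoℚ m = (+ m) / 1

{-# OPTIONS --safe #-}

-- Peel vertices off the ground set, charging to each v removed vertices at most
-- v (n max(1/8, t/2) + O(1)) removed members.  Call {a, b} rigid if every member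
-- contains both or neither of a, b.
--
-- A vertex of degree at most 27 is removed at once.  If no such vertex is left, every
-- member contains a rigid pair: large degrees produce, by pigeonhole on
-- intersections, triples lying in more than 3 members ("fat"); a member meeting a fat
-- triple meets it twice, every fat triple has a fat neighbour sharing two of its
-- vertices, and these two vertices form a rigid pair.
--
-- For a member {a, b, c, e} with {a, b} rigid, either {c, e} is rigid or c and e are
-- satellites: they occur only together with a and b.  The v satellites of a rigid
-- pair lie in at most min(v²/2, d) ≤ t n v / 2 members, and are removed together.  Without
-- satellites every member is a union of two rigid pairs, so m vertices have degrees at
-- most m/2 and carry at most m²/8 members.
module Submission where

open import Defs
open import Data.Nat as Nat using (ℕ; zero; suc; _≥_; z≤n; s≤s)
import Data.Nat.Properties as ℕₚ
open import Data.Nat.Properties using (module ≤-Reasoning)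
open import Data.Nat.Tactic.RingSolver using (solve-∀)
open import Data.Bool using (true; false)
open import Data.Fin using (Fin; _≟_)
open import Data.Fin.Properties using () renaming (any? to anyFin?)
open import Data.Fin.Subset using (Subset; _∈_; _∉_; _∩_; _-_; ∣_∣; inside; outside)
open import Data.Fin.Subset.Properties
  using (_∈?_; nonempty?; ⊆-antisym; x∈p∩q⁺; x∈p∩q⁻; p─q⊆p; p─⊥≡p; x∈p∧x≢y⇒x∈p-y;
         ∣⊥∣≡0; Empty-unique)
open import Data.Vec using ([]; _∷_; here; there)
open import Data.List
  using (List; []; _∷_; length; filter; map; foldr; concatMap; allFin)
open import Data.List.Properties
  using (length-filter; length-map; length-tabulate; filter-some; filter-accept; filter-reject)
open import Data.List.Membership.Propositional
  using (find; lose) renaming (_∈_ to _∈ˡ_; _∉_ to _∉ˡ_)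
open import Data.List.Membership.Propositional.Properties
  using (∈-filter⁺; ∈-filter⁻; ∈-map⁻; ∈-allFin; ∈-concatMap⁺)
open import Data.List.Membership.DecPropositional using () renaming (_∈?_ to member?)
open import Data.List.Relation.Unary.Any as Any using (Any; here; there)
import Data.List.Relation.Unary.Any.Properties as Anyₚ
open import Data.List.Relation.Unary.All as All using (All; []; _∷_)
open import Data.List.Relation.Unary.All.Properties
  using (anti-mono; ¬Any⇒All¬; All¬⇒¬Any; ¬All⇒Any¬)
open import Data.List.Relation.Unary.AllPairs using ([]; _∷_)
open import Data.List.Relation.Unary.Unique.Propositional using (Unique)
import Data.List.Relation.Unary.Unique.Propositional.Properties as Uniqueₚ
open import Data.Product using (∃; ∃-syntax; _×_; _,_; proj₁; proj₂)
open import Data.Sum using (_⊎_; inj₁; inj₂)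
open import Function using (_∘_; id; case_of_)
open import Level using (0ℓ)
open import Relation.Nullary using (¬_; Dec; yes; no; contradiction)
open import Relation.Nullary.Decidable using (_×-dec_; _→-dec_; ¬?; decidable-stable)
open import Relation.Unary using (Pred; Decidable)
open import Relation.Binary.PropositionalEquality


-- Counting in lists and double counting.

private variable
  X Y : Set

opaque
  count : {P : Pred X 0ℓ} → Decidable P → List X → ℕ
  count P? xs = length (filter P? xs)

  count-filter : {P : Pred X 0ℓ} (P? : Decidable P) → ∀ xs → count P? xs ≡ length (filter P? xs)
  count-filter P? xs = refl

  count-accept : {P : Pred X 0ℓ} (P? : Decidable P) → ∀ {x xs} → P x →
    count P? (x ∷ xs) ≡ suc (count P? xs)
  count-accept P? px = cong length (filter-accept P? px)

  count-reject : {P : Pred X 0ℓ} (P? : Decidable P) → ∀ {x xs} → ¬ P x →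
    count P? (x ∷ xs) ≡ count P? xs
  count-reject P? ¬px = cong length (filter-reject P? ¬px)

  count-[] : {P : Pred X 0ℓ} (P? : Decidable P) → count P? [] ≡ 0
  count-[] P? = refl

module DoubleCount {R : Y → X → Set} (R? : ∀ y x → Dec (R y x)) where
  open Nat using (_+_; _*_; _≤_)

  -- Summed row by row over `xs`; `incidences-∷` splits the same sum along `ys`.
  incidences : List X → List Y → ℕ
  incidences []       ys = 0
  incidences (x ∷ xs) ys = count (λ y → R? y x) ys + incidences xs ys

  private
    +-left-swap : ∀ a b c → a + (b + c) ≡ b + (a + c)
    +-left-swap a b c = trans (sym (ℕₚ.+-assoc a b c))
      (trans (cong (_+ c) (ℕₚ.+-comm a b)) (ℕₚ.+-assoc b a c))

    incidences-[] : ∀ xs → incidences xs [] ≡ 0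
    incidences-[] []       = refl
    incidences-[] (x ∷ xs) = cong₂ _+_ (count-[] (λ y → R? y x)) (incidences-[] xs)

    incidences-∷ : ∀ xs y ys →
      incidences xs (y ∷ ys) ≡ count (R? y) xs + incidences xs ys
    incidences-∷ []       y ys = sym (cong (_+ 0) (count-[] (R? y)))
    incidences-∷ (x ∷ xs) y ys with R? y x
    ... | yes r = trans
      (cong₂ _+_ (count-accept (λ z → R? z x) r) (incidences-∷ xs y ys))
      (trans (cong suc (+-left-swap (count (λ z → R? z x) ys) (count (R? y) xs) (incidences xs ys)))
        (cong (_+ (count (λ z → R? z x) ys + incidences xs ys)) (sym (count-accept (R? y) r))))
    ... | no ¬r = trans
      (cong₂ _+_ (count-reject (λ z → R? z x) ¬r) (incidences-∷ xs y ys))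
      (trans (+-left-swap (count (λ z → R? z x) ys) (count (R? y) xs) (incidences xs ys))
        (cong (_+ (count (λ z → R? z x) ys + incidences xs ys)) (sym (count-reject (R? y) ¬r))))

    lower : ∀ p xs ys → (∀ {x} → x ∈ˡ xs → p ≤ count (λ y → R? y x) ys) →
      p * length xs ≤ incidences xs ys
    lower p []       ys h = ℕₚ.≤-reflexive (ℕₚ.*-zeroʳ p)
    lower p (x ∷ xs) ys h = subst (_≤ incidences (x ∷ xs) ys) (sym (ℕₚ.*-suc p (length xs)))
      (ℕₚ.+-mono-≤ (h (here refl)) (lower p xs ys (h ∘ there)))

    upper : ∀ q xs ys → (∀ {y} → y ∈ˡ ys → count (R? y) xs ≤ q) →
      incidences xs ys ≤ q * length ys
    upper q xs []       h = subst (_≤ _) (sym (incidences-[] xs)) z≤n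
    upper q xs (y ∷ ys) h =
      subst₂ _≤_ (sym (incidences-∷ xs y ys)) (sym (ℕₚ.*-suc q (length ys)))
        (ℕₚ.+-mono-≤ (h (here refl)) (upper q xs ys (h ∘ there)))

  -- The two products bound the number of related pairs from below, counted from `xs`, and from
  -- above, counted from `ys`.
  double-count : ∀ p q xs ys →
    (∀ {x} → x ∈ˡ xs → p ≤ count (λ y → R? y x) ys) →
    (∀ {y} → y ∈ˡ ys → count (R? y) xs ≤ q) →
    p * length xs ≤ q * length ys
  double-count p q xs ys h k = ℕₚ.≤-trans (lower p xs ys h) (upper q xs ys k)

open DoubleCount using (double-count)

unique-all-equal : {xs : List X} → Unique xs →
  (∀ {x y} → x ∈ˡ xs → y ∈ˡ xs → x ≡ y) → length xs Nat.≤ 1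
unique-all-equal {xs = []}         _ _ = z≤n
unique-all-equal {xs = _ ∷ []}     _ _ = s≤s z≤n
unique-all-equal {xs = _ ∷ _ ∷ _} ((x≢y ∷ _) ∷ _) h =
  contradiction (h (here refl) (there (here refl))) x≢y

module _ {P : Pred X 0ℓ} (P? : Decidable P) where

  count-pos : ∀ {x xs} → x ∈ˡ xs → P x → 1 Nat.≤ count P? xs
  count-pos {xs = xs} x∈ px = subst (1 Nat.≤_) (sym (count-filter P? xs)) (filter-some P? (lose x∈ px))

  opaque
    count-pos⁻ : ∀ xs → 1 Nat.≤ count P? xs → ∃[ x ] (x ∈ˡ xs × P x)
    count-pos⁻ xs h with filter P? xs in eq | subst (1 Nat.≤_) (count-filter P? xs) h
    ... | y ∷ ys | _ = y , ∈-filter⁻ P? (subst (y ∈ˡ_) (sym eq) (here refl))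

  count-≤1 : ∀ {xs} → Unique xs →
    (∀ {x y} → x ∈ˡ xs → y ∈ˡ xs → P x → P y → x ≡ y) → count P? xs Nat.≤ 1
  count-≤1 {xs} u h = subst (Nat._≤ 1) (sym (count-filter P? xs))
    (unique-all-equal (Uniqueₚ.filter⁺ P? u) λ i j →
      let (x∈ , px) = ∈-filter⁻ P? i ; (y∈ , py) = ∈-filter⁻ P? j in h x∈ y∈ px py)

opaque
  unfolding count

  count-complement : {P : Pred X 0ℓ} (P? : Decidable P) → ∀ xs →
    count P? xs Nat.+ count (¬? ∘ P?) xs ≡ length xs
  count-complement P? []       = refl
  count-complement P? (x ∷ xs) with P? x
  ... | yes _ = cong suc (count-complement P? xs)
  ... | no  _ = trans (ℕₚ.+-suc _ _) (cong suc (count-complement P? xs))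

  count-mono : {P Q : Pred X 0ℓ} (P? : Decidable P) (Q? : Decidable Q) → ∀ xs →
    (∀ {x} → x ∈ˡ xs → P x → Q x) → count P? xs Nat.≤ count Q? xs
  count-mono P? Q? []       h = z≤n
  count-mono P? Q? (x ∷ xs) h with P? x | Q? x
  ... | yes p | yes q = s≤s (count-mono P? Q? xs (h ∘ there))
  ... | yes p | no ¬q = contradiction (h (here refl) p) ¬q
  ... | no _  | yes q = ℕₚ.m≤n⇒m≤1+n (count-mono P? Q? xs (h ∘ there))
  ... | no _  | no _  = count-mono P? Q? xs (h ∘ there)

  count-filter-≤ : {P Q : Pred X 0ℓ} (P? : Decidable P) (Q? : Decidable Q) → ∀ xs →
    count P? (filter Q? xs) Nat.≤ count P? xs
  count-filter-≤ P? Q? []       = z≤n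
  count-filter-≤ P? Q? (x ∷ xs) with Q? x
  ... | yes _ with P? x
  ...   | yes _ = s≤s (count-filter-≤ P? Q? xs)
  ...   | no _  = count-filter-≤ P? Q? xs
  count-filter-≤ P? Q? (x ∷ xs) | no _ with P? x
  ...   | yes _ = ℕₚ.m≤n⇒m≤1+n (count-filter-≤ P? Q? xs)
  ...   | no _  = count-filter-≤ P? Q? xs

module _ {n : ℕ} where

  -- Double counting for equality: each entry of `L` occurs in the filtered `V`, and by uniqueness
  -- of `L` each entry there is matched at most once.
  count-≥ : {P : Pred (Fin n) 0ℓ} (P? : Decidable P) {L V : List (Fin n)} →
    Unique L → (∀ {v} → v ∈ˡ L → v ∈ˡ V × P v) → length L Nat.≤ count P? V
  count-≥ P? {L} {V} u h = subst₂ Nat._≤_ (ℕₚ.+-identityʳ _)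
    (trans (ℕₚ.+-identityʳ _) (sym (count-filter P? V)))
    (double-count (λ y x → x ≟ y) 1 1 L (filter P? V)
      (λ {x} x∈ → count-pos (x ≟_) (∈-filter⁺ P? (proj₁ (h x∈)) (proj₂ (h x∈))) refl)
      (λ {y} _ → count-≤1 (_≟ y) u λ _ _ p q → trans p (sym q)))

-- Sizes of subsets and lists of their elements.

∣p∣≡1+∣p-x∣ : ∀ {n} {p : Subset n} {x} → x ∈ p → ∣ p ∣ ≡ suc ∣ p - x ∣
∣p∣≡1+∣p-x∣ {p = _ ∷ p}       here        = cong suc (cong ∣_∣ (sym (p─⊥≡p p)))
∣p∣≡1+∣p-x∣ {p = inside ∷ p}  (there x∈p) = cong suc (∣p∣≡1+∣p-x∣ x∈p)
∣p∣≡1+∣p-x∣ {p = outside ∷ p} (there x∈p) = ∣p∣≡1+∣p-x∣ x∈p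

x∉p-x : ∀ {n} (p : Subset n) x → x ∉ p - x
x∉p-x (true ∷ p)  Fin.zero    ()
x∉p-x (false ∷ p) Fin.zero    ()
x∉p-x (_ ∷ p)     (Fin.suc x) (there h) = x∉p-x p x h

module _ {n : ℕ} where

  ∈p-x⁻ : ∀ {p : Subset n} {x y} → y ∈ p - x → y ∈ p × y ≢ x
  ∈p-x⁻ {p} {x} h = p─q⊆p p _ h , λ { refl → x∉p-x p x h }

  private
    remove-All : ∀ {p : Subset n} {x L} → All (x ≢_) L → All (_∈ p) L → All (_∈ p - x) L
    remove-All x∉L h = All.zipWith (λ (x≢y , y∈p) → x∈p∧x≢y⇒x∈p-y y∈p (x≢y ∘ sym)) (x∉L , h)

  opaque
    -- Induction on `L`: deleting its head from `p` lowers both sizes by one.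
    full : ∀ {p : Subset n} {L} → Unique L → All (_∈ p) L → ∣ p ∣ ≡ length L →
      ∀ {v} → v ∈ p → v ∈ˡ L
    full [] [] eq v∈p = contradiction (trans (sym eq) (∣p∣≡1+∣p-x∣ v∈p)) λ ()
    full {L = x ∷ L} (x∉L ∷ u) (x∈p ∷ h) eq {v} v∈p with v ≟ x
    ... | yes v≡x = here v≡x
    ... | no  v≢x = there (full u (remove-All x∉L h)
      (ℕₚ.suc-injective (trans (sym (∣p∣≡1+∣p-x∣ x∈p)) eq)) (x∈p∧x≢y⇒x∈p-y v∈p v≢x))

  opaque
    extend : ∀ {p : Subset n} {L} → Unique L → All (_∈ p) L → length L Nat.< ∣ p ∣ →
      ∃[ v ] (v ∈ p × All (v ≢_) L)
    extend {p} [] [] lt with nonempty? p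
    ... | yes (v , v∈p) = v , v∈p , []
    ... | no ¬ne = contradiction
      (subst (1 Nat.≤_) (trans (cong ∣_∣ (Empty-unique ¬ne)) (∣⊥∣≡0 n)) lt) λ ()
    extend {p} (x∉L ∷ u) (x∈p ∷ h) lt =
      let (v , v∈ , v∉L) = extend u (remove-All x∉L h)
            (ℕₚ.≤-pred (subst (_ Nat.<_) (∣p∣≡1+∣p-x∣ x∈p) lt))
          (v∈p , v≢x) = ∈p-x⁻ v∈
      in v , v∈p , v≢x ∷ v∉L

-- Independent families: intersections, codegrees and pigeonhole.

module Family {n : ℕ} (A : List (Subset n)) (independent : IsIndependentSet A) where
  open Nat using (_+_; _*_; _≤_; _<_; _<?_; _≤?_)

  uniqueA : Unique A
  uniqueA = proj₁ independent

  size : ∀ {F} → F ∈ˡ A → ∣ F ∣ ≡ 4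
  size = All.lookup (proj₁ (proj₂ independent))

  opaque
    -- Independence forbids intersections of size exactly one, so `x` cannot be the only common
    -- vertex.
    meet : ∀ {F G x} → F ∈ˡ A → G ∈ˡ A → x ∈ F → x ∈ G →
      ∃[ v ] (v ≢ x × v ∈ F × v ∈ G)
    meet {F} {G} {x} F∈ G∈ x∈F x∈G with nonempty? (F ∩ G - x)
    ... | yes (v , v∈) =
      let (v∈∩ , v≢x) = ∈p-x⁻ v∈ ; (v∈F , v∈G) = x∈p∩q⁻ F G v∈∩ in v , v≢x , v∈F , v∈G
    ... | no ¬ne = contradiction
      (trans (∣p∣≡1+∣p-x∣ (x∈p∩q⁺ (x∈F , x∈G)))
        (cong suc (trans (cong ∣_∣ (Empty-unique ¬ne)) (∣⊥∣≡0 n))))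
      (proj₂ (proj₂ independent) F∈ G∈)

  opaque
    others : ∀ {F x} → F ∈ˡ A → x ∈ F →
      ∃[ b ] ∃[ c ] ∃[ e ] (Unique (b ∷ c ∷ e ∷ x ∷ []) × All (_∈ F) (b ∷ c ∷ e ∷ x ∷ []))
    others {F} F∈ x∈F =
      let lt : ∀ {k} → k < 4 → k < ∣ F ∣
          lt = subst (_ <_) (sym (size F∈))
          u₁ = [] ∷ []
          (e , e∈ , e∉) = extend u₁ (x∈F ∷ []) (lt (s≤s (s≤s z≤n)))
          (c , c∈ , c∉) = extend (e∉ ∷ u₁) (e∈ ∷ x∈F ∷ []) (lt (s≤s (s≤s (s≤s z≤n))))
          (b , b∈ , b∉) = extend (c∉ ∷ e∉ ∷ u₁) (c∈ ∷ e∈ ∷ x∈F ∷ [])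
            (lt (s≤s (s≤s (s≤s (s≤s z≤n)))))
      in b , c , e , (b∉ ∷ c∉ ∷ e∉ ∷ u₁) , (b∈ ∷ c∈ ∷ e∈ ∷ x∈F ∷ [])

  opaque
    covered : ∀ {F L} → F ∈ˡ A → Unique L → All (_∈ F) L → length L ≡ 4 →
      ∀ {v} → v ∈ F → v ∈ˡ L
    covered {F} F∈ u h len = full {p = F} u h (trans (size F∈) (sym len))

  opaque
    determined : ∀ {F G L} → F ∈ˡ A → G ∈ˡ A → Unique L → length L ≡ 4 →
      All (_∈ F) L → All (_∈ G) L → F ≡ G
    determined F∈ G∈ u len hF hG = ⊆-antisym
      (All.lookup hG ∘ covered F∈ u hF len) (All.lookup hF ∘ covered G∈ u hG len)

  contains? : (T : List (Fin n)) → Decidable (λ (F : Subset n) → All (_∈ F) T)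
  contains? T F = All.all? (_∈? F) T

  -- For a singleton this is the degree of a vertex; for a pair of distinct vertices it is one of
  -- the numbers whose maximum is `d`.
  codeg : List (Fin n) → ℕ
  codeg T = count (contains? T) A

  codeg-anti : ∀ {T T′} → (∀ {v} → v ∈ˡ T → v ∈ˡ T′) → codeg T′ ≤ codeg T
  codeg-anti {T} {T′} T⊆T′ =
    count-mono (contains? T′) (contains? T) A λ _ → anti-mono T⊆T′

  codeg≤1 : ∀ {T} → Unique T → length T ≡ 4 → codeg T ≤ 1
  codeg≤1 {T} u len = count-≤1 (contains? T) uniqueA λ F∈ G∈ → determined F∈ G∈ u len

  opaque
    -- If every set in `Ts` had codegree at most `k`, together they could cover at most
    -- `k * length Ts` members containing `T`.
    pigeonhole : ∀ k T Ts →
      (∀ {F} → F ∈ˡ A → All (_∈ F) T → Any (λ T′ → All (_∈ F) T′) Ts) →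
      k * length Ts < codeg T → ∃[ T′ ] (T′ ∈ˡ Ts × k < codeg T′)
    pigeonhole k T Ts h lt with Any.any? (λ T′ → k <? codeg T′) Ts
    ... | yes found = find found
    ... | no ¬found = contradiction lt (ℕₚ.≤⇒≯ (subst (_≤ k * length Ts)
      (trans (ℕₚ.+-identityʳ _) (sym (count-filter (contains? T) A)))
      (double-count contains? 1 k (filter (contains? T) A) Ts
        (λ F∈ → let (F∈A , T⊆F) = ∈-filter⁻ (contains? T) F∈
                    (T′ , T′∈ , T′⊆F) = find (h F∈A T⊆F)
                in count-pos (λ T′ → contains? T′ _) T′∈ T′⊆F)
        (λ {T′} T′∈ → ℕₚ.≤-trans (count-filter-≤ (contains? T′) (contains? T) A)
          (ℕₚ.≮⇒≥ (λ k< → ¬found (lose T′∈ k<)))))))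

  -- Every member through x ∈ S meets S in a second vertex, one of the three others.
  opaque
    branch : ∀ k {S x T} → S ∈ˡ A → x ∈ S → x ∈ˡ T → k * 3 < codeg T →
      ∃[ z ] (z ∈ S × z ≢ x × k < codeg (z ∷ T))
    branch k {S} {x} {T} S∈ x∈S x∈T lt
      with others S∈ x∈S
    ... | b , c , e , u@((_ ∷ _ ∷ b≢x ∷ []) ∷ (_ ∷ c≢x ∷ []) ∷ (e≢x ∷ []) ∷ _) , S∋@(b∈ ∷ c∈ ∷ e∈ ∷ _)
      with pigeonhole k T ((b ∷ T) ∷ (c ∷ T) ∷ (e ∷ T) ∷ []) cover lt
      where
      cover : ∀ {F} → F ∈ˡ A → All (_∈ F) T →
        Any (λ T′ → All (_∈ F) T′) ((b ∷ T) ∷ (c ∷ T) ∷ (e ∷ T) ∷ [])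
      cover F∈ T⊆F with meet F∈ S∈ (All.lookup T⊆F x∈T) x∈S
      ... | v , v≢x , v∈F , v∈S with covered S∈ u S∋ refl v∈S
      ... | here refl                         = here (v∈F ∷ T⊆F)
      ... | there (here refl)                 = there (here (v∈F ∷ T⊆F))
      ... | there (there (here refl))         = there (there (here (v∈F ∷ T⊆F)))
      ... | there (there (there (here refl))) = contradiction refl v≢x
    ... | _ , here refl , k< = b , b∈ , b≢x , k<
    ... | _ , there (here refl) , k< = c , c∈ , c≢x , k<
    ... | _ , there (there (here refl)) , k< = e , e∈ , e≢x , k<

  -- Fat triples.

  -- With more than three members there are at least four different fourth vertices, so three
  -- prescribed outside vertices can be avoided at once; `escape` rests on this.
  Fat : Fin n → Fin n → Fin n → Set
  Fat x y z = Unique (x ∷ y ∷ z ∷ []) × 3 < codeg (x ∷ y ∷ z ∷ [])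

  fat-swap₁₂ : ∀ {x y z} → Fat x y z → Fat y x z
  fat-swap₁₂ ((x≢y ∷ x≢z ∷ []) ∷ (y≢z ∷ []) ∷ _ , 3<) =
    ((x≢y ∘ sym ∷ y≢z ∷ []) ∷ (x≢z ∷ []) ∷ [] ∷ []) ,
    ℕₚ.≤-trans 3< (codeg-anti λ where
      (here refl)                 → there (here refl)
      (there (here refl))         → here refl
      (there (there (here refl))) → there (there (here refl)))

  fat-swap₂₃ : ∀ {x y z} → Fat x y z → Fat x z y
  fat-swap₂₃ ((x≢y ∷ x≢z ∷ []) ∷ (y≢z ∷ []) ∷ _ , 3<) =
    ((x≢z ∷ x≢y ∷ []) ∷ (y≢z ∘ sym ∷ []) ∷ [] ∷ []) ,
    ℕₚ.≤-trans 3< (codeg-anti λ where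
      (here refl)                 → here refl
      (there (here refl))         → there (there (here refl))
      (there (there (here refl))) → there (here refl))

  opaque
    fat-member : ∀ {x y z} → Fat x y z →
      ∃[ F ] (F ∈ˡ A × All (_∈ F) (x ∷ y ∷ z ∷ []))
    fat-member {x} {y} {z} (_ , 3<) =
      count-pos⁻ (contains? (x ∷ y ∷ z ∷ [])) A (ℕₚ.≤-trans (s≤s z≤n) 3<)

  opaque
    -- Members through the triple differ in their fourth vertex, and there are more members than
    -- entries of `L`.
    escape : ∀ {x y z} → Fat x y z → ∀ L → length L ≤ 3 →
      ∃[ F ] (F ∈ˡ A × All (_∈ F) (x ∷ y ∷ z ∷ []) ×
              (∀ {v} → v ∈ˡ L → v ∈ F → v ∈ˡ x ∷ y ∷ z ∷ []))
    escape {x} {y} {z} (u , 3<) L len = go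
      where
      T : List (Fin n)
      T = x ∷ y ∷ z ∷ []
      new? : Decidable (λ v → v ∉ˡ T)
      new? v = ¬? (member? _≟_ v T)
      L′ : List (Fin n)
      L′ = filter new? L

      goal? : Decidable λ F → All (_∈ F) T × All (λ v → v ∉ F) L′
      goal? F = contains? T F ×-dec All.all? (λ v → ¬? (v ∈? F)) L′

      go : ∃[ F ] (F ∈ˡ A × All (_∈ F) T × (∀ {v} → v ∈ˡ L → v ∈ F → v ∈ˡ T))
      go with Any.any? goal? A
      ... | yes found = let (F , F∈ , T⊆F , L∉F) = find found in
        F , F∈ , T⊆F , λ {v} v∈L v∈F → decidable-stable (member? _≟_ v T)
          (λ v∉T → All.lookup L∉F (∈-filter⁺ new? v∈L v∉T) v∈F)
      ... | no ¬found
        -- If every member through `T` hit `L′`, some `v ∷ T` would lie in two members, although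
        -- four vertices determine a member.
        with pigeonhole 1 T (map (_∷ T) L′)
          (λ {F} F∈ T⊆F →
            let hit = ¬All⇒Any¬ (λ v → ¬? (v ∈? F)) L′ (λ L∉F → ¬found (lose F∈ (T⊆F , L∉F)))
            in Anyₚ.map⁺ (Any.map (λ {v} ¬∉ → decidable-stable (v ∈? F) ¬∉ ∷ T⊆F) hit))
          (ℕₚ.≤-<-trans
            (ℕₚ.≤-trans (ℕₚ.≤-reflexive (trans (ℕₚ.+-identityʳ _) (length-map (_∷ T) L′)))
              (ℕₚ.≤-trans (length-filter new? L) len))
            3<)
      ... | _ , T′∈ , 1< with ∈-map⁻ (_∷ T) T′∈
      ... | v , v∈ , refl = contradiction 1<
        (ℕₚ.≤⇒≯ (codeg≤1 (¬Any⇒All¬ T (proj₂ (∈-filter⁻ new? {xs = L} v∈)) ∷ u) refl))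

  opaque
    -- Since `x` belongs to the triple, only the three other vertices of `S` have to be avoided.
    escape-member : ∀ {x y z S} → Fat x y z → S ∈ˡ A → x ∈ S →
      ∃[ F ] (F ∈ˡ A × All (_∈ F) (x ∷ y ∷ z ∷ []) ×
              (∀ {v} → v ∈ S → v ∈ F → v ∈ˡ x ∷ y ∷ z ∷ []))
    escape-member fat S∈ x∈S with others S∈ x∈S
    ... | b , c , e , u , S∋ with escape fat (b ∷ c ∷ e ∷ []) ℕₚ.≤-refl
    ... | F , F∈ , T⊆F , L∉F = F , F∈ , T⊆F , λ v∈S v∈F →
      case covered S∈ u S∋ refl v∈S of λ where
        (here refl)                         → L∉F (here refl) v∈F
        (there (here refl))                 → L∉F (there (here refl)) v∈F
        (there (there (here refl)))         → L∉F (there (there (here refl))) v∈F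
        (there (there (there (here refl)))) → here refl

  opaque
    -- Some member through the triple meets `S` only inside the triple, and by independence it
    -- shares a vertex other than `x` with `S`.
    fat-second : ∀ {x y z S} → Fat x y z → S ∈ˡ A → x ∈ S → y ∈ S ⊎ z ∈ S
    fat-second fat S∈ x∈S with escape-member fat S∈ x∈S
    ... | F , F∈ , (x∈F ∷ _) , F∩S⊆T with meet S∈ F∈ x∈S x∈F
    ... | v , v≢x , v∈S , v∈F with F∩S⊆T v∈S v∈F
    ... | here v≡x                    = contradiction v≡x v≢x
    ... | there (here refl)           = inj₁ v∈S
    ... | there (there (here refl))   = inj₂ v∈S

  opaque
    -- A member through the first triple can be chosen to avoid `c` and `e` unless they lie in that
    -- triple, yet it contains `x` and so, by `fat-second`, one of `c`, `e`.
    fat-overlap : ∀ {x a b c e} → Fat x a b → Fat x c e → c ∈ˡ a ∷ b ∷ [] ⊎ e ∈ˡ a ∷ b ∷ []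
    fat-overlap {c = c} {e} fat fat′@((x≢c ∷ x≢e ∷ []) ∷ _ , _)
      with escape fat (c ∷ e ∷ []) (s≤s (s≤s z≤n))
    ... | F , F∈ , (x∈F ∷ _) , avoid with fat-second fat′ F∈ x∈F
    ... | inj₁ c∈F = case avoid (here refl) c∈F of λ where
      (here c≡x) → contradiction (sym c≡x) x≢c
      (there c∈) → inj₁ c∈
    ... | inj₂ e∈F = case avoid (there (here refl)) e∈F of λ where
      (here e≡x) → contradiction (sym e≡x) x≢e
      (there e∈) → inj₂ e∈

  -- Rigid pairs forced by large degrees.

  Rigid : Fin n → Fin n → Set
  Rigid a b = All (λ F → (a ∈ F → b ∈ F) × (b ∈ F → a ∈ F)) A

  rigid? : ∀ a b → Dec (Rigid a b)
  rigid? a b = All.all?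
    (λ F → (a ∈? F →-dec b ∈? F) ×-dec (b ∈? F →-dec a ∈? F)) A

  rigid-sym : ∀ {a b} → Rigid a b → Rigid b a
  rigid-sym = All.map λ (f , g) → g , f

  rigid-to : ∀ {a b F} → Rigid a b → F ∈ˡ A → a ∈ F → b ∈ F
  rigid-to r F∈ = proj₁ (All.lookup r F∈)

  HasRigidPair : Subset n → Set
  HasRigidPair F = ∃[ a ] ∃[ b ] (a ≢ b × a ∈ F × b ∈ F × Rigid a b)

  -- The thresholds 27, 9, 3 are what three pigeonholes with three holes each consume.
  module LargeDegrees (large : ∀ {F v} → F ∈ˡ A → v ∈ F → 27 < codeg (v ∷ [])) where

    opaque
      -- A member through `w` meets `F` in a vertex of the fat triple, hence in two of them by
      -- `fat-second`. So three triples through `w` cover its more than 27 members.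
      fat-neighbour : ∀ {x y z w F} → Fat x y z → F ∈ˡ A → All (_∈ F) (w ∷ x ∷ y ∷ z ∷ []) →
        All (w ≢_) (x ∷ y ∷ z ∷ []) → Fat w x y ⊎ Fat w x z ⊎ Fat w y z
      fat-neighbour {x} {y} {z} {w} {F} fat@(u@((x≢y ∷ x≢z ∷ []) ∷ (y≢z ∷ []) ∷ _) , _)
        F∈ F∋@(w∈F ∷ x∈F ∷ y∈F ∷ z∈F ∷ []) w∉@(w≢x ∷ w≢y ∷ w≢z ∷ [])
        with pigeonhole 9 (w ∷ [])
          ((w ∷ x ∷ y ∷ []) ∷ (w ∷ x ∷ z ∷ []) ∷ (w ∷ y ∷ z ∷ []) ∷ []) cover (large F∈ w∈F)
        where
        cover : ∀ {G} → G ∈ˡ A → All (_∈ G) (w ∷ []) → Any (λ T → All (_∈ G) T)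
          ((w ∷ x ∷ y ∷ []) ∷ (w ∷ x ∷ z ∷ []) ∷ (w ∷ y ∷ z ∷ []) ∷ [])
        cover G∈ (w∈G ∷ []) with meet G∈ F∈ w∈G w∈F
        ... | v , v≢w , v∈G , v∈F with covered F∈ (w∉ ∷ u) F∋ refl v∈F
        ... | here v≡w = contradiction v≡w v≢w
        ... | there (here refl) with fat-second fat G∈ v∈G
        ...   | inj₁ y∈G = here (w∈G ∷ v∈G ∷ y∈G ∷ [])
        ...   | inj₂ z∈G = there (here (w∈G ∷ v∈G ∷ z∈G ∷ []))
        cover G∈ (w∈G ∷ []) | v , v≢w , v∈G , v∈F | there (there (here refl))
          with fat-second (fat-swap₁₂ fat) G∈ v∈G
        ...   | inj₁ x∈G = here (w∈G ∷ x∈G ∷ v∈G ∷ [])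
        ...   | inj₂ z∈G = there (there (here (w∈G ∷ v∈G ∷ z∈G ∷ [])))
        cover G∈ (w∈G ∷ []) | v , v≢w , v∈G , v∈F | there (there (there (here refl)))
          with fat-second (fat-swap₁₂ (fat-swap₂₃ fat)) G∈ v∈G
        ...   | inj₁ x∈G = there (here (w∈G ∷ x∈G ∷ v∈G ∷ []))
        ...   | inj₂ y∈G = there (there (here (w∈G ∷ y∈G ∷ v∈G ∷ [])))
      ... | _ , here refl , 9< = inj₁
        (((w≢x ∷ w≢y ∷ []) ∷ (x≢y ∷ []) ∷ [] ∷ []) , ℕₚ.≤-trans (s≤s (s≤s (s≤s (s≤s z≤n)))) 9<)
      ... | _ , there (here refl) , 9< = inj₂ (inj₁
        (((w≢x ∷ w≢z ∷ []) ∷ (x≢z ∷ []) ∷ [] ∷ []) , ℕₚ.≤-trans (s≤s (s≤s (s≤s (s≤s z≤n)))) 9<))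
      ... | _ , there (there (here refl)) , 9< = inj₂ (inj₂
        (((w≢y ∷ w≢z ∷ []) ∷ (y≢z ∷ []) ∷ [] ∷ []) , ℕₚ.≤-trans (s≤s (s≤s (s≤s (s≤s z≤n)))) 9<))

    opaque
      -- If `y` were missing, `S` would contain both `z` and `w`. A fourth vertex `w′` outside `S`
      -- then yields another fat triple, incompatible either with `S` or with the triple of `w`.
      fat-pair-implies : ∀ {x y z w S} → Fat x y z → Fat w x y → w ≢ z → S ∈ˡ A → x ∈ S → y ∈ S
      fat-pair-implies {x} {y} {z} {w} {S} fat@(uT@((x≢y ∷ x≢z ∷ []) ∷ (y≢z ∷ []) ∷ _) , _)
        fatw@((w≢x ∷ w≢y ∷ []) ∷ _ , _) w≢z S∈ x∈S
        with y ∈? S | fat-second fat S∈ x∈S | fat-second (fat-swap₁₂ fatw) S∈ x∈S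
      ... | yes y∈S | _ | _ = y∈S
      ... | no y∉S | inj₁ y∈S | _ = y∈S
      ... | no y∉S | inj₂ z∈S | inj₂ y∈S = y∈S
      -- The chosen `F` meets `S` only in the triple, so its fourth vertex `w′` lies outside `S` and
      -- differs from `w`.
      ... | no y∉S | inj₂ z∈S | inj₁ w∈S with escape-member fat S∈ x∈S
      ... | F , F∈ , T⊆F , F∩S⊆T
        with extend uT T⊆F (subst (3 <_) (sym (size F∈)) ℕₚ.≤-refl)
      ... | w′ , w′∈F , w′∉T@(w′≢x ∷ w′≢y ∷ w′≢z ∷ []) = go (fat-neighbour fat F∈ (w′∈F ∷ T⊆F) w′∉T)
        where
        w′∉S : w′ ∉ S
        w′∉S w′∈S = All¬⇒¬Any w′∉T (F∩S⊆T w′∈S w′∈F)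
        w′≢w : w′ ≢ w
        w′≢w refl = w′∉S w∈S
        go : Fat w′ x y ⊎ Fat w′ x z ⊎ Fat w′ y z → y ∈ S
        go (inj₁ f) with fat-second (fat-swap₁₂ f) S∈ x∈S
        ... | inj₁ w′∈S = contradiction w′∈S w′∉S
        ... | inj₂ y∈S  = y∈S
        -- Fat triples with a common vertex must share a second one, but `w`, `x`, `y` and `w′`,
        -- `x`, `z` share only `x`; the last case is the same at `y`.
        go (inj₂ (inj₁ f)) with fat-overlap (fat-swap₁₂ fatw) (fat-swap₁₂ f)
        ... | inj₁ (here w′≡w)         = contradiction w′≡w w′≢w
        ... | inj₁ (there (here w′≡y)) = contradiction w′≡y w′≢y
        ... | inj₂ (here z≡w)          = contradiction (sym z≡w) w≢z
        ... | inj₂ (there (here z≡y))  = contradiction (sym z≡y) y≢z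
        go (inj₂ (inj₂ f)) with fat-overlap (fat-swap₁₂ (fat-swap₂₃ fatw)) (fat-swap₁₂ f)
        ... | inj₁ (here w′≡w)         = contradiction w′≡w w′≢w
        ... | inj₁ (there (here w′≡x)) = contradiction w′≡x w′≢x
        ... | inj₂ (here z≡w)          = contradiction (sym z≡w) w≢z
        ... | inj₂ (there (here z≡x))  = contradiction (sym z≡x) x≢z

    opaque
      fat-pair-rigid : ∀ {x y z w} → Fat x y z → Fat w x y → w ≢ z → Rigid x y
      fat-pair-rigid fat fatw w≢z = All.tabulate λ S∈ →
        fat-pair-implies fat fatw w≢z S∈ ,
        fat-pair-implies (fat-swap₁₂ fat) (fat-swap₂₃ fatw) w≢z S∈

    rigid-meets : ∀ {a b F} → a ≢ b → Rigid a b → F ∈ˡ A → a ∈ F ⊎ b ∈ F → HasRigidPair F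
    rigid-meets a≢b r F∈ (inj₁ a∈F) = _ , _ , a≢b , a∈F , rigid-to r F∈ a∈F , r
    rigid-meets a≢b r F∈ (inj₂ b∈F) = _ , _ , a≢b , rigid-to (rigid-sym r) F∈ b∈F , b∈F , r

    opaque
      -- The fourth vertex of a member through the triple gives a fat neighbour, and the two shared
      -- vertices are rigid. If they are `y` and `z`, `fat-second` puts one of them into `F`.
      fat-gives-rigid : ∀ {x y z F} → Fat x y z → F ∈ˡ A → x ∈ F → HasRigidPair F
      fat-gives-rigid {x} {y} {z} fat@(uT@((x≢y ∷ x≢z ∷ []) ∷ (y≢z ∷ []) ∷ _) , _) F∈ x∈F
        with fat-member fat
      ... | G , G∈ , T⊆G with extend uT T⊆G (subst (3 <_) (sym (size G∈)) ℕₚ.≤-refl)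
      ... | w , w∈G , w∉T@(w≢x ∷ w≢y ∷ w≢z ∷ [])
        with fat-neighbour fat G∈ (w∈G ∷ T⊆G) w∉T
      ... | inj₁ f = rigid-meets x≢y (fat-pair-rigid fat f w≢z) F∈ (inj₁ x∈F)
      ... | inj₂ (inj₁ f) =
        rigid-meets x≢z (fat-pair-rigid (fat-swap₂₃ fat) f w≢y) F∈ (inj₁ x∈F)
      ... | inj₂ (inj₂ f) =
        rigid-meets y≢z (fat-pair-rigid (fat-swap₂₃ (fat-swap₁₂ fat)) f w≢x) F∈
          (fat-second fat F∈ x∈F)

    opaque
      -- Every member through `x` and `y` has a further vertex in `S`, which differs from `y`
      -- because `S` misses `y`.
      fat-of-split : ∀ {x y S} → x ≢ y → 9 < codeg (y ∷ x ∷ []) → S ∈ˡ A → x ∈ S → y ∉ S →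
        ∃[ z ] Fat x y z
      fat-of-split x≢y 9< S∈ x∈S y∉S with branch 3 S∈ x∈S (there (here refl)) 9<
      ... | z , z∈S , z≢x , 3< = z , fat-swap₂₃ (fat-swap₁₂ (fat-swap₂₃
        (((λ { refl → y∉S z∈S }) ∷ z≢x ∷ []) ∷ (x≢y ∘ sym ∷ []) ∷ [] ∷ [] , 3<)))

    opaque
      -- The degree of `x` yields a pair of `F` with codegree above 9. If the pair is not rigid, a
      -- member splitting it produces a fat triple through a vertex of `F`.
      has-rigid-pair : ∀ {F} → F ∈ˡ A → HasRigidPair F
      has-rigid-pair {F} F∈ with extend [] [] (subst (0 <_) (sym (size F∈)) (s≤s z≤n))
      ... | x , x∈F , _ with branch 9 F∈ x∈F (here refl) (large F∈ x∈F)
      ... | y , y∈F , y≢x , 9< with rigid? x y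
      ... | yes r = x , y , y≢x ∘ sym , x∈F , y∈F , r
      ... | no ¬r with find (¬All⇒Any¬ (λ S → (x ∈? S →-dec y ∈? S) ×-dec (y ∈? S →-dec x ∈? S)) A ¬r)
      ... | S , S∈ , split with x ∈? S | y ∈? S
      ... | yes x∈S | yes y∈S = contradiction ((λ _ → y∈S) , (λ _ → x∈S)) split
      ... | no x∉S  | no y∉S  = contradiction ((λ x∈S → contradiction x∈S x∉S) , (λ y∈S → contradiction y∈S y∉S)) split
      ... | yes x∈S | no y∉S  =
        let (z , fat) = fat-of-split (y≢x ∘ sym) 9< S∈ x∈S y∉S in fat-gives-rigid fat F∈ x∈F
      ... | no x∉S  | yes y∈S =
        let (z , fat) = fat-of-split y≢x
              (ℕₚ.≤-trans 9< (codeg-anti λ { (here refl) → there (here refl) ; (there (here refl)) → here refl }))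
              S∈ y∈S x∉S
        in fat-gives-rigid fat F∈ y∈F

  -- The complement of a rigid pair in a member.

  Attached : Fin n → Fin n → Set
  Attached a c = All (λ F → c ∈ F → a ∈ F) A

  attached? : ∀ a c → Dec (Attached a c)
  attached? a c = All.all? (λ F → c ∈? F →-dec a ∈? F) A

  -- Attachment is recorded for `a` only; when `a`, `b` are rigid, `b` follows.
  Satellite : Fin n → Fin n → Fin n → Set
  Satellite a b c = c ≢ a × c ≢ b × Attached a c

  satellite? : ∀ a b c → Dec (Satellite a b c)
  satellite? a b c = ¬? (c ≟ a) ×-dec ¬? (c ≟ b) ×-dec attached? a c

  opaque
    complete₃ : ∀ {F T} → F ∈ˡ A → Unique T → All (_∈ F) T → length T ≡ 3 →
      ∃[ e ] (e ∈ F × All (e ≢_) T)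
    complete₃ F∈ u T⊆F len =
      extend u T⊆F (subst₂ _<_ (sym len) (sym (size F∈)) ℕₚ.≤-refl)

  opaque
    complete₂ : ∀ {F a b} → F ∈ˡ A → a ≢ b → a ∈ F → b ∈ F →
      ∃[ c ] ∃[ e ] (Unique (e ∷ c ∷ a ∷ b ∷ []) × All (_∈ F) (e ∷ c ∷ a ∷ b ∷ []))
    complete₂ F∈ a≢b a∈F b∈F =
      let u = (a≢b ∷ []) ∷ [] ∷ []
          (c , c∈F , c∉) = extend u (a∈F ∷ b∈F ∷ [])
            (subst (2 <_) (sym (size F∈)) (s≤s (s≤s (s≤s z≤n))))
          (e , e∈F , e∉) = complete₃ F∈ (c∉ ∷ u) (c∈F ∷ a∈F ∷ b∈F ∷ []) refl
      in c , e , (e∉ ∷ c∉ ∷ u) , (e∈F ∷ c∈F ∷ a∈F ∷ b∈F ∷ [])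

  module RigidPairs (has-rigid : ∀ {F} → F ∈ˡ A → HasRigidPair F) where

    opaque
      -- Suppose `e` is not in `H`. Without `a`, the members `F` and `H` would share only `c`. With
      -- `a`, `H` consists of `a`, `b`, `c` and a vertex `v` of `G` outside `F`, which leaves no
      -- room for the rigid pair of `G`.
      detached-implies : ∀ {F G H a b c e} → F ∈ˡ A → G ∈ˡ A → H ∈ˡ A → Rigid a b →
        Unique (e ∷ c ∷ a ∷ b ∷ []) → All (_∈ F) (e ∷ c ∷ a ∷ b ∷ []) →
        c ∈ G → e ∈ G → a ∉ G → c ∈ H → e ∈ H
      detached-implies {F} {G} {H} {a} {b} {c} {e} F∈ G∈ H∈ ab
        u@((e≢c ∷ _ ∷ _ ∷ []) ∷ uT@((c≢a ∷ c≢b ∷ []) ∷ (a≢b ∷ []) ∷ _))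
        F∋@(e∈F ∷ c∈F ∷ a∈F ∷ b∈F ∷ []) c∈G e∈G a∉G c∈H with e ∈? H | a ∈? H
      ... | yes e∈H | _ = e∈H
      ... | no e∉H | no a∉H with meet F∈ H∈ c∈F c∈H
      ... | v , v≢c , v∈F , v∈H with covered F∈ u F∋ refl v∈F
      ... | here refl                         = v∈H
      ... | there (here refl)                 = contradiction refl v≢c
      ... | there (there (here refl))         = contradiction v∈H a∉H
      ... | there (there (there (here refl))) =
        contradiction (rigid-to (rigid-sym ab) H∈ v∈H) a∉H
      detached-implies {F} {G} {H} {a} {b} {c} {e} F∈ G∈ H∈ ab
        u@((e≢c ∷ _ ∷ _ ∷ []) ∷ uT@((c≢a ∷ c≢b ∷ []) ∷ (a≢b ∷ []) ∷ _))
        F∋@(e∈F ∷ c∈F ∷ a∈F ∷ b∈F ∷ []) c∈G e∈G a∉G c∈H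
        | no e∉H | yes a∈H with meet H∈ G∈ c∈H c∈G | has-rigid G∈
      ... | v , v≢c , v∈H , v∈G | g , h , g≢h , g∈G , h∈G , gh = go (g ∈? F)
        where
        b∉G : b ∉ G
        b∉G b∈G = a∉G (rigid-to (rigid-sym ab) G∈ b∈G)
        F∩G : ∀ {w} → w ∈ F → w ∈ G → w ≡ e ⊎ w ≡ c
        F∩G w∈F w∈G with covered F∈ u F∋ refl w∈F
        ... | here w≡e                          = inj₁ w≡e
        ... | there (here w≡c)                  = inj₂ w≡c
        ... | there (there (here refl))         = contradiction w∈G a∉G
        ... | there (there (there (here refl))) = contradiction w∈G b∉G
        v∉F : v ∉ F
        v∉F v∈F with F∩G v∈F v∈G
        ... | inj₁ refl = e∉H v∈H
        ... | inj₂ v≡c  = v≢c v≡c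
        ∉F⇒≢ : ∀ {w z} → w ∉ F → z ∈ F → w ≢ z
        ∉F⇒≢ w∉F z∈F refl = w∉F z∈F
        H-outside-F : ∀ {w} → w ∈ H → w ∉ F → w ≡ v
        H-outside-F w∈H w∉F with covered H∈
          ((∉F⇒≢ v∉F c∈F ∷ ∉F⇒≢ v∉F a∈F ∷ ∉F⇒≢ v∉F b∈F ∷ []) ∷ uT)
          (v∈H ∷ c∈H ∷ a∈H ∷ rigid-to ab H∈ a∈H ∷ []) refl w∈H
        ... | here w≡v                          = w≡v
        ... | there (here refl)                 = contradiction c∈F w∉F
        ... | there (there (here refl))         = contradiction a∈F w∉F
        ... | there (there (there (here refl))) = contradiction b∈F w∉F
        go : Dec (g ∈ F) → e ∈ H
        -- A rigid pair of `G` with a vertex in `F` lies wholly in `F`, so it consists of `c` and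
        -- `e`.
        go (yes g∈F) with F∩G g∈F g∈G | F∩G (rigid-to gh F∈ g∈F) h∈G
        ... | inj₁ refl | inj₁ refl = contradiction refl g≢h
        ... | inj₁ refl | inj₂ refl = rigid-to (rigid-sym gh) H∈ c∈H
        ... | inj₂ refl | inj₁ refl = rigid-to gh H∈ c∈H
        ... | inj₂ refl | inj₂ refl = contradiction refl g≢h
        -- Now `G` consists of `g`, `h`, `c`, `e`, so `v` is `g` or `h` and `H` contains both; but
        -- `v` is the only vertex of `H` outside `F`.
        go (no g∉F) = contradiction (trans (H-outside-F g∈H g∉F) (sym (H-outside-F h∈H h∉F))) g≢h
          where
          h∉F : h ∉ F
          h∉F h∈F = g∉F (rigid-to (rigid-sym gh) F∈ h∈F)
          gh⊆H : v ≡ g ⊎ v ≡ h → g ∈ H × h ∈ H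
          gh⊆H (inj₁ refl) = v∈H , rigid-to gh H∈ v∈H
          gh⊆H (inj₂ refl) = rigid-to (rigid-sym gh) H∈ v∈H , v∈H
          v∈gh : v ≡ g ⊎ v ≡ h
          v∈gh with covered G∈
            ((g≢h ∷ ∉F⇒≢ g∉F e∈F ∷ ∉F⇒≢ g∉F c∈F ∷ []) ∷
             (∉F⇒≢ h∉F e∈F ∷ ∉F⇒≢ h∉F c∈F ∷ []) ∷ (e≢c ∷ []) ∷ [] ∷ [])
            (g∈G ∷ h∈G ∷ e∈G ∷ c∈G ∷ []) refl v∈G
          ... | here v≡g                          = inj₁ v≡g
          ... | there (here v≡h)                  = inj₂ v≡h
          ... | there (there (here refl))         = contradiction e∈F v∉F
          ... | there (there (there (here refl))) = contradiction c∈F v∉F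
          g∈H : g ∈ H
          g∈H = proj₁ (gh⊆H v∈gh)
          h∈H : h ∈ H
          h∈H = proj₂ (gh⊆H v∈gh)

    swap-unique : ∀ {e c a b : Fin n} → Unique (e ∷ c ∷ a ∷ b ∷ []) → Unique (c ∷ e ∷ a ∷ b ∷ [])
    swap-unique ((e≢c ∷ e∉) ∷ c∉ ∷ u) = (e≢c ∘ sym ∷ c∉) ∷ e∉ ∷ u

    swap-all : ∀ {e c a b} {F : Subset n} → All (_∈ F) (e ∷ c ∷ a ∷ b ∷ []) → All (_∈ F) (c ∷ e ∷ a ∷ b ∷ [])
    swap-all (e∈ ∷ c∈ ∷ ab∈) = c∈ ∷ e∈ ∷ ab∈

    opaque
      -- A member with `c` but without `a` also misses `b`, so its second common vertex with `F` is
      -- `e`. Now `c` and `e` play symmetric parts.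
      detached-rigid : ∀ {F a b c e} → F ∈ˡ A → Rigid a b →
        Unique (e ∷ c ∷ a ∷ b ∷ []) → All (_∈ F) (e ∷ c ∷ a ∷ b ∷ []) →
        ¬ Attached a c → Rigid c e
      detached-rigid {F} {a} {b} {c} {e} F∈ ab u F∋@(e∈F ∷ c∈F ∷ _) ¬att
        with find (¬All⇒Any¬ (λ G → c ∈? G →-dec a ∈? G) A ¬att)
      ... | G , G∈ , ¬imp with c ∈? G | a ∈? G
      ... | no c∉G  | _       = contradiction (λ c∈G → contradiction c∈G c∉G) ¬imp
      ... | yes _   | yes a∈G = contradiction (λ _ → a∈G) ¬imp
      ... | yes c∈G | no a∉G  = All.tabulate λ H∈ →
        detached-implies F∈ G∈ H∈ ab u F∋ c∈G e∈G a∉G ,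
        detached-implies F∈ G∈ H∈ ab (swap-unique u) (swap-all F∋) e∈G c∈G a∉G
        where
        e∈G : e ∈ G
        e∈G with meet F∈ G∈ c∈F c∈G
        ... | v , v≢c , v∈F , v∈G with covered F∈ u F∋ refl v∈F
        ... | here refl                         = v∈G
        ... | there (here v≡c)                  = contradiction v≡c v≢c
        ... | there (there (here refl))         = contradiction v∈G a∉G
        ... | there (there (there (here refl))) =
          contradiction (rigid-to (rigid-sym ab) G∈ v∈G) a∉G

    opaque
      rigid-or-attached : ∀ {F a b c e} → F ∈ˡ A → Rigid a b →
        Unique (e ∷ c ∷ a ∷ b ∷ []) → All (_∈ F) (e ∷ c ∷ a ∷ b ∷ []) →
        Rigid c e ⊎ (Attached a c × Attached a e)
      rigid-or-attached {a = a} {c = c} {e} F∈ ab u F∋ with attached? a c | attached? a e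
      ... | no ¬att | _       = inj₁ (detached-rigid F∈ ab u F∋ ¬att)
      ... | yes _   | no ¬att =
        inj₁ (rigid-sym (detached-rigid F∈ ab (swap-unique u) (swap-all F∋) ¬att))
      ... | yes c-att | yes e-att = inj₂ (c-att , e-att)

    -- Counting the members through the satellites of one pair.

    module _ (U : List (Fin n)) (spans : ∀ {F v} → F ∈ˡ A → v ∈ F → v ∈ˡ U) where

      module Satellites {a b : Fin n} (a≢b : a ≢ b) (ab : Rigid a b) where

        Touched : Subset n → Set
        Touched F = ∃[ c ] (Satellite a b c × c ∈ F)

        touched? : Decidable Touched
        touched? F = anyFin? λ c → satellite? a b c ×-dec c ∈? F

        satellites : ℕ
        satellites = count (satellite? a b) U

        centre-in : ∀ {F c} → F ∈ˡ A → Satellite a b c → c ∈ F → a ∈ F × b ∈ F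
        centre-in F∈ (_ , _ , att) c∈F =
          let a∈F = All.lookup att F∈ c∈F in a∈F , rigid-to ab F∈ a∈F

        opaque
          -- The fourth vertex is attached itself, or it is rigid with `c` and inherits the
          -- attachment of `c`.
          second-satellite : ∀ {F c} → F ∈ˡ A → Satellite a b c → c ∈ F →
            ∃[ e ] (Satellite a b e × e ∈ F × e ≢ c)
          second-satellite F∈ sat@(c≢a , c≢b , att) c∈F
            with centre-in F∈ sat c∈F
          ... | a∈F , b∈F
            with complete₃ F∈ ((c≢a ∷ c≢b ∷ []) ∷ (a≢b ∷ []) ∷ [] ∷ []) (c∈F ∷ a∈F ∷ b∈F ∷ []) refl
          ... | e , e∈F , e∉@(e≢c ∷ e≢a ∷ e≢b ∷ [])
            with rigid-or-attached F∈ ab (e∉ ∷ (c≢a ∷ c≢b ∷ []) ∷ (a≢b ∷ []) ∷ [] ∷ [])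
              (e∈F ∷ c∈F ∷ a∈F ∷ b∈F ∷ [])
          ... | inj₁ ce = e , (e≢a , e≢b , All.tabulate λ G∈ e∈G →
              All.lookup att G∈ (rigid-to (rigid-sym ce) G∈ e∈G)) , e∈F , e≢c
          ... | inj₂ (_ , e-att) = e , (e≢a , e≢b , e-att) , e∈F , e≢c

        opaque
          touched≤codeg : count touched? A ≤ codeg (a ∷ b ∷ [])
          touched≤codeg = count-mono touched? (contains? (a ∷ b ∷ [])) A λ F∈ (_ , sat , c∈F) →
            let (a∈F , b∈F) = centre-in F∈ sat c∈F in a∈F ∷ b∈F ∷ []

        opaque
          -- A touched member through `c` consists of `a`, `b`, `c` and a second satellite, which
          -- determines it.
          touched-degree : ∀ {c} → Satellite a b c →
            count (c ∈?_) (filter touched? A) ≤ satellites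
          touched-degree {c} sat@(c≢a , c≢b , _) = subst₂ _≤_
            (trans (ℕₚ.*-identityˡ _) (sym (count-filter (c ∈?_) (filter touched? A))))
            (trans (ℕₚ.*-identityˡ _) (sym (count-filter (satellite? a b) U)))
            (double-count R? 1 1 (filter (c ∈?_) (filter touched? A)) (filter (satellite? a b) U)
              some
              (λ {e} e∈ → count-≤1 (R? e) (Uniqueₚ.filter⁺ (c ∈?_) (Uniqueₚ.filter⁺ touched? uniqueA))
                (unique-set (proj₂ (∈-filter⁻ (satellite? a b) {xs = U} e∈)))))
            where
            R? : ∀ (e : Fin n) (F : Subset n) → Dec (e ≢ c × e ∈ F)
            R? e F = ¬? (e ≟ c) ×-dec e ∈? F
            memb : ∀ {F} → F ∈ˡ filter (c ∈?_) (filter touched? A) → F ∈ˡ A × c ∈ F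
            memb F∈ = let (F∈′ , c∈F) = ∈-filter⁻ (c ∈?_) F∈
                      in proj₁ (∈-filter⁻ touched? F∈′) , c∈F
            some : ∀ {F} → F ∈ˡ filter (c ∈?_) (filter touched? A) →
              1 ≤ count (λ e → R? e F) (filter (satellite? a b) U)
            some {F} F∈ with memb F∈
            ... | F∈A , c∈F with second-satellite F∈A sat c∈F
            ... | e , e-sat , e∈F , e≢c =
              count-pos (λ v → R? v F) (∈-filter⁺ (satellite? a b) (spans F∈A e∈F) e-sat) (e≢c , e∈F)
            unique-set : ∀ {e} → Satellite a b e → ∀ {F G} →
              F ∈ˡ filter (c ∈?_) (filter touched? A) → G ∈ˡ filter (c ∈?_) (filter touched? A) →
              e ≢ c × e ∈ F → e ≢ c × e ∈ G → F ≡ G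
            unique-set (e≢a , e≢b , _) F∈ G∈ (e≢c , e∈F) (_ , e∈G) =
              let (F∈A , c∈F) = memb F∈ ; (G∈A , c∈G) = memb G∈
                  (a∈F , b∈F) = centre-in F∈A sat c∈F
                  (a∈G , b∈G) = centre-in G∈A sat c∈G
              in determined F∈A G∈A
                ((e≢c ∷ e≢a ∷ e≢b ∷ []) ∷ (c≢a ∷ c≢b ∷ []) ∷ (a≢b ∷ []) ∷ [] ∷ []) refl
                (e∈F ∷ c∈F ∷ a∈F ∷ b∈F ∷ []) (e∈G ∷ c∈G ∷ a∈G ∷ b∈G ∷ [])

        opaque
          -- Each touched member contains two satellites, and `touched-degree` bounds the touched
          -- members through each of them.
          touched-quadratic : 2 * count touched? A ≤ satellites * satellites
          touched-quadratic = subst₂ _≤_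
            (cong (2 *_) (sym (count-filter touched? A)))
            (cong (satellites *_) (sym (count-filter (satellite? a b) U)))
            (double-count (λ c F → c ∈? F) 2 satellites (filter touched? A) (filter (satellite? a b) U)
              two (λ c∈ → touched-degree (proj₂ (∈-filter⁻ (satellite? a b) {xs = U} c∈))))
            where
            two : ∀ {F} → F ∈ˡ filter touched? A →
              2 ≤ count (λ c → c ∈? F) (filter (satellite? a b) U)
            two {F} F∈ with ∈-filter⁻ touched? F∈
            ... | F∈A , c , sat , c∈F with second-satellite F∈A sat c∈F
            ... | e , e-sat , e∈F , e≢c = count-≥ (λ c → c ∈? F)
              ((e≢c ∷ []) ∷ [] ∷ []) λ where
                (here refl)         → ∈-filter⁺ (satellite? a b) (spans F∈A e∈F) e-sat , e∈F
                (there (here refl)) → ∈-filter⁺ (satellite? a b) (spans F∈A c∈F) sat , c∈F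

      -- Families without satellites.

      module Paired
        (no-satellite : ∀ {a b c} → c ∈ˡ U → a ≢ b → Rigid a b → ¬ Satellite a b c) where
        open import Data.Nat.DivMod using (_/_; m/n*n≤m; m*n/n≡m; /-monoˡ-≤)

        opaque
          complement-rigid : ∀ {F a b c e} → F ∈ˡ A → Rigid a b →
            Unique (e ∷ c ∷ a ∷ b ∷ []) → All (_∈ F) (e ∷ c ∷ a ∷ b ∷ []) → Rigid c e
          complement-rigid F∈ ab u@(_ ∷ (c≢a ∷ c≢b ∷ []) ∷ (a≢b ∷ []) ∷ _) F∋@(_ ∷ c∈F ∷ _)
            with rigid-or-attached F∈ ab u F∋
          ... | inj₁ ce          = ce
          ... | inj₂ (c-att , _) =
            contradiction (c≢a , c≢b , c-att) (no-satellite (spans F∈ c∈F) a≢b ab)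

        opaque
          partner : ∀ {F x} → F ∈ˡ A → x ∈ F → ∃[ y ] (x ≢ y × Rigid x y)
          partner F∈ x∈F with has-rigid F∈
          ... | a , b , a≢b , a∈F , b∈F , ab with complete₂ F∈ a≢b a∈F b∈F
          ... | c , e , u@((e≢c ∷ _) ∷ _) , F∋ with complement-rigid F∈ ab u F∋ | covered F∈ u F∋ refl x∈F
          ... | ce | here refl                         = c , e≢c , rigid-sym ce
          ... | ce | there (here refl)                 = e , e≢c ∘ sym , ce
          ... | ce | there (there (here refl))         = b , a≢b , ab
          ... | ce | there (there (there (here refl))) = a , a≢b ∘ sym , rigid-sym ab

        opaque
          -- Each member through `x` has two vertices besides `x` and `y`. Either of the two fixes
          -- the other as its rigid partner, so no vertex of `U` serves two members.
          paired-degree : ∀ {x y} → x ≢ y → Rigid x y → 2 * count (x ∈?_) A ≤ length U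
          paired-degree {x} {y} x≢y xy = subst₂ _≤_
            (cong (2 *_) (sym (count-filter (x ∈?_) A))) (ℕₚ.*-identityˡ _)
            (double-count R? 2 1 (filter (x ∈?_) A) U two
              (λ {w} w∈U → count-≤1 (R? w) (Uniqueₚ.filter⁺ (x ∈?_) uniqueA) unique-set))
            where
            R? : ∀ (w : Fin n) (F : Subset n) → Dec (w ≢ x × w ≢ y × w ∈ F)
            R? w F = ¬? (w ≟ x) ×-dec ¬? (w ≟ y) ×-dec w ∈? F
            two : ∀ {F} → F ∈ˡ filter (x ∈?_) A → 2 ≤ count (λ w → R? w F) U
            two {F} F∈ with ∈-filter⁻ (x ∈?_) F∈
            ... | F∈A , x∈F with complete₂ F∈A x≢y x∈F (rigid-to xy F∈A x∈F)
            ... | c , e , ((e≢c ∷ e≢x ∷ e≢y ∷ []) ∷ (c≢x ∷ c≢y ∷ []) ∷ _) , (e∈F ∷ c∈F ∷ _) =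
              count-≥ (λ w → R? w F) ((e≢c ∷ []) ∷ [] ∷ []) λ where
                (here refl)         → spans F∈A e∈F , e≢x , e≢y , e∈F
                (there (here refl)) → spans F∈A c∈F , c≢x , c≢y , c∈F
            unique-set : ∀ {w F G} → F ∈ˡ filter (x ∈?_) A → G ∈ˡ filter (x ∈?_) A →
              w ≢ x × w ≢ y × w ∈ F → w ≢ x × w ≢ y × w ∈ G → F ≡ G
            unique-set {w} {F} F∈ G∈ (w≢x , w≢y , w∈F) (_ , _ , w∈G)
              with ∈-filter⁻ (x ∈?_) {xs = A} F∈ | ∈-filter⁻ (x ∈?_) {xs = A} G∈
            ... | F∈A , x∈F | G∈A , x∈G
              with complete₃ F∈A ((w≢x ∷ w≢y ∷ []) ∷ (x≢y ∷ []) ∷ [] ∷ [])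
                (w∈F ∷ x∈F ∷ rigid-to xy F∈A x∈F ∷ []) refl
            ... | e , e∈F , e∉ = determined F∈A G∈A u refl F∋
                -- The partner `e` of `w` follows `w` into `G`, so both members contain the same
                -- four vertices.
                (rigid-to (complement-rigid F∈A xy u F∋) G∈A w∈G ∷ w∈G ∷ x∈G ∷ rigid-to xy G∈A x∈G ∷ [])
              where
              u : Unique (e ∷ w ∷ x ∷ y ∷ [])
              u = e∉ ∷ (w≢x ∷ w≢y ∷ []) ∷ (x≢y ∷ []) ∷ [] ∷ []
              F∋ : All (_∈ F) (e ∷ w ∷ x ∷ y ∷ [])
              F∋ = e∈F ∷ w∈F ∷ x∈F ∷ rigid-to xy F∈A x∈F ∷ []

        opaque
          degree-half : ∀ x → 2 * count (x ∈?_) A ≤ length U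
          degree-half x with 1 ≤? count (x ∈?_) A
          ... | yes 1≤ = let (F , F∈ , x∈F) = count-pos⁻ (x ∈?_) A 1≤
                             (y , x≢y , xy) = partner F∈ x∈F
                         in paired-degree x≢y xy
          ... | no ¬1≤ = subst (λ k → 2 * k ≤ length U) (sym (ℕₚ.n<1⇒n≡0 (ℕₚ.≰⇒> ¬1≤))) z≤n

        opaque
          -- Each member has four vertices in `U`, and each vertex has degree at most `m / 2`; the
          -- division rounds down, which is harmless as degrees are integers.
          paired-quadratic : 8 * length A ≤ length U * length U
          paired-quadratic = ℕₚ.≤-trans
            (subst (_≤ 2 * (m / 2 * m)) (sym (ℕₚ.*-assoc 2 4 (length A)))
              (ℕₚ.*-monoʳ-≤ 2 (double-count (λ x F → x ∈? F) 4 (m / 2) A U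
                four (λ {x} _ → ≤-half (degree-half x)))))
            (subst (_≤ m * m) (trans (cong (_* m) (ℕₚ.*-comm (m / 2) 2)) (ℕₚ.*-assoc 2 (m / 2) m))
              (ℕₚ.*-monoˡ-≤ m (m/n*n≤m m 2)))
            where
            m : ℕ
            m = length U
            ≤-half : ∀ {k} → 2 * k ≤ m → k ≤ m / 2
            ≤-half {k} h = subst (_≤ m / 2) (m*n/n≡m k 2) (/-monoˡ-≤ 2 (subst (_≤ m) (ℕₚ.*-comm 2 k) h))
            four : ∀ {F} → F ∈ˡ A → 4 ≤ count (λ x → x ∈? F) U
            four {F} F∈ with has-rigid F∈
            ... | a , b , a≢b , a∈F , b∈F , _ with complete₂ F∈ a≢b a∈F b∈F
            ... | c , e , u , F∋ = count-≥ (λ x → x ∈? F) u λ v∈ →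
              spans F∈ (All.lookup F∋ v∈) , All.lookup F∋ v∈

-- Costs of the three kinds of removal, and the induction.

-- The fraction s / q stands for t n, so Sparse says 2 codeg ≤ (t n)².
module Peeling (n q s : ℕ) .{{_ : Nat.NonZero q}} where
  open Nat using (_+_; _*_; _≤_; _<_; _⊔_; _≤?_)

  -- Divided by `8 * q` this is max(n/8, tn/2) + 27, the number of members charged to one vertex.
  rate : ℕ
  rate = (q * n) ⊔ (4 * s) + 216 * q

  peel : ∀ (A : List (Subset n)) (U : List (Fin n)) {M : Pred (Subset n) 0ℓ} (M? : Decidable M)
    {W : Pred (Fin n) 0ℓ} (W? : Decidable W) →
    8 * q * count M? A ≤ rate * count W? U →
    8 * q * length (filter (¬? ∘ M?) A) ≤ rate * length (filter (¬? ∘ W?) U) →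
    8 * q * length A ≤ rate * length U
  peel A U M? W? removed kept = subst₂ _≤_
    (trans (sym (ℕₚ.*-distribˡ-+ (8 * q) _ _))
      (cong (8 * q *_) (trans (cong (count M? A +_) (sym (count-filter (¬? ∘ M?) A))) (count-complement M? A))))
    (trans (sym (ℕₚ.*-distribˡ-+ rate _ _))
      (cong (rate *_) (trans (cong (count W? U +_) (sym (count-filter (¬? ∘ W?) U))) (count-complement W? U))))
    (ℕₚ.+-mono-≤ removed kept)

  -- The smaller of v² and (s/q)² is at most their geometric mean, so 2r ≤ v s/q.
  satellite-cost : ∀ r v → 2 * r ≤ v * v → 2 * (q * q) * r ≤ s * s → 8 * q * r ≤ rate * v
  satellite-cost r v 2r≤v² 2q²r≤s² = begin
    8 * q * r               ≡⟨ eq₁ q r ⟩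
    4 * (q * (2 * r))       ≤⟨ ℕₚ.*-monoʳ-≤ 4 core ⟩
    4 * (s * v)             ≡⟨ ℕₚ.*-assoc 4 s v ⟨
    4 * s * v               ≤⟨ ℕₚ.*-monoˡ-≤ v (ℕₚ.≤-trans (ℕₚ.m≤n⊔m (q * n) (4 * s)) (ℕₚ.m≤m+n ((q * n) ⊔ (4 * s)) (216 * q))) ⟩
    rate * v                ∎
    where
    open ≤-Reasoning
    eq₁ : ∀ q r → 8 * q * r ≡ 4 * (q * (2 * r))
    eq₁ = solve-∀
    eq₂ : ∀ q v → q * (v * v) ≡ q * v * v
    eq₂ = solve-∀
    eq₃ : ∀ q r → q * (q * (2 * r)) ≡ 2 * (q * q) * r
    eq₃ = solve-∀
    eq₄ : ∀ s q v → s * (q * v) ≡ q * (s * v)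
    eq₄ = solve-∀
    core : q * (2 * r) ≤ s * v
    -- For v ≤ s/q the quadratic bound suffices, otherwise the codegree bound.
    core with ℕₚ.≤-total (q * v) s
    ... | inj₁ qv≤s = begin
      q * (2 * r)  ≤⟨ ℕₚ.*-monoʳ-≤ q 2r≤v² ⟩
      q * (v * v)  ≡⟨ eq₂ q v ⟩
      q * v * v    ≤⟨ ℕₚ.*-monoˡ-≤ v qv≤s ⟩
      s * v        ∎
    ... | inj₂ s≤qv = ℕₚ.*-cancelˡ-≤ q (begin
      q * (q * (2 * r))  ≡⟨ eq₃ q r ⟩
      2 * (q * q) * r    ≤⟨ 2q²r≤s² ⟩
      s * s              ≤⟨ ℕₚ.*-monoʳ-≤ s s≤qv ⟩
      s * (q * v)        ≡⟨ eq₄ s q v ⟩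
      q * (s * v)        ∎)

  -- The summand `216 * q` of `rate` pays, as 216 is 8 times 27.
  low-degree-cost : ∀ r v → r ≤ 27 → 1 ≤ v → 8 * q * r ≤ rate * v
  low-degree-cost r v r≤27 1≤v = begin
    8 * q * r    ≤⟨ ℕₚ.*-monoʳ-≤ (8 * q) r≤27 ⟩
    8 * q * 27   ≡⟨ eq q ⟩
    216 * q      ≤⟨ ℕₚ.m≤n+m (216 * q) ((q * n) ⊔ (4 * s)) ⟩
    rate         ≡⟨ ℕₚ.*-identityʳ rate ⟨
    rate * 1     ≤⟨ ℕₚ.*-monoʳ-≤ rate 1≤v ⟩
    rate * v     ∎
    where
    open ≤-Reasoning
    eq : ∀ q → 8 * q * 27 ≡ 216 * q
    eq = solve-∀

  paired-cost : ∀ l m → m ≤ n → 8 * l ≤ m * m → 8 * q * l ≤ rate * m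
  paired-cost l m m≤n 8l≤m² = begin
    8 * q * l    ≡⟨ eq q l ⟩
    q * (8 * l)  ≤⟨ ℕₚ.*-monoʳ-≤ q 8l≤m² ⟩
    q * (m * m)  ≤⟨ ℕₚ.*-monoʳ-≤ q (ℕₚ.*-monoˡ-≤ m m≤n) ⟩
    q * (n * m)  ≡⟨ ℕₚ.*-assoc q n m ⟨
    q * n * m    ≤⟨ ℕₚ.*-monoˡ-≤ m (ℕₚ.≤-trans (ℕₚ.m≤m⊔n (q * n) (4 * s)) (ℕₚ.m≤m+n ((q * n) ⊔ (4 * s)) (216 * q))) ⟩
    rate * m     ∎
    where
    open ≤-Reasoning
    eq : ∀ q l → 8 * q * l ≡ q * (8 * l)
    eq = solve-∀

  Spans : List (Fin n) → List (Subset n) → Set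
  Spans U A = ∀ {F v} → F ∈ˡ A → v ∈ F → v ∈ˡ U

  pair? : (a b : Fin n) → Decidable (λ (F : Subset n) → All (_∈ F) (a ∷ b ∷ []))
  pair? a b F = All.all? (_∈? F) (a ∷ b ∷ [])

  Sparse : List (Subset n) → Set
  Sparse A = ∀ {a b} → a ≢ b → 2 * (q * q) * count (pair? a b) A ≤ s * s

  filter-independent : ∀ {A} {M : Pred (Subset n) 0ℓ} (M? : Decidable M) →
    IsIndependentSet A → IsIndependentSet (filter M? A)
  filter-independent {A} M? (u , sizes , indep) =
    Uniqueₚ.filter⁺ M? u ,
    All.tabulate (λ F∈ → All.lookup sizes (proj₁ (∈-filter⁻ M? {xs = A} F∈))) ,
    λ F∈ G∈ → indep (proj₁ (∈-filter⁻ M? F∈)) (proj₁ (∈-filter⁻ M? G∈))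

  -- Strong induction on the size of `U`, with `k` as decreasing bound; `length U ≤ n` is carried
  -- along for `paired-cost`.
  bounded : ∀ k U A → IsIndependentSet A → Spans U A → Sparse A →
    length U < k → length U ≤ n → 8 * q * length A ≤ rate * length U
  bounded (suc k) U A independent spans sparse U<k U≤n = step
    where
    open Family A independent

    -- Because `M` holds for every member with a vertex in `W`, the kept members live on the kept
    -- vertices; at least one vertex goes, so `U` shrinks.
    recurse : {M : Pred (Subset n) 0ℓ} (M? : Decidable M) {W : Pred (Fin n) 0ℓ} (W? : Decidable W) →
      (∀ {F v} → F ∈ˡ A → v ∈ F → W v → M F) → 1 ≤ count W? U →
      8 * q * count M? A ≤ rate * count W? U →
      8 * q * length A ≤ rate * length U
    recurse M? W? hit 1≤ cost = peel A U M? W? cost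
      (bounded k U′ A′ (filter-independent (¬? ∘ M?) independent) spans′ sparse′
        (ℕₚ.<-≤-trans U′<U (ℕₚ.≤-pred U<k)) (ℕₚ.≤-trans (ℕₚ.<⇒≤ U′<U) U≤n))
      where
      A′ : List (Subset n)
      A′ = filter (¬? ∘ M?) A
      U′ : List (Fin n)
      U′ = filter (¬? ∘ W?) U
      spans′ : Spans U′ A′
      spans′ F∈ v∈F = let (F∈A , ¬MF) = ∈-filter⁻ (¬? ∘ M?) F∈ in
        ∈-filter⁺ (¬? ∘ W?) (spans F∈A v∈F) (λ Wv → ¬MF (hit F∈A v∈F Wv))
      sparse′ : Sparse A′
      sparse′ {a} {b} a≢b = ℕₚ.≤-trans
        (ℕₚ.*-monoʳ-≤ (2 * (q * q)) (count-filter-≤ (pair? a b) (¬? ∘ M?) A)) (sparse a≢b)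
      U′<U : length U′ < length U
      U′<U = subst (length U′ <_)
        (trans (cong (count W? U +_) (sym (count-filter (¬? ∘ W?) U))) (count-complement W? U))
        (ℕₚ.+-monoˡ-≤ (length U′) 1≤)

    step : 8 * q * length A ≤ rate * length U
    step with Any.any? (λ x → codeg (x ∷ []) ≤? 27) U
    ... | yes low = let (x , x∈U , deg≤27) = find low in
      recurse (contains? (x ∷ [])) (_≟ x) (λ { _ v∈F refl → v∈F ∷ [] })
        (count-pos (_≟ x) x∈U refl)
        (low-degree-cost _ _ deg≤27 (count-pos (_≟ x) x∈U refl))
    ... | no ¬low = branches
      where
      open LargeDegrees (λ F∈ v∈F → ℕₚ.≰⇒> (λ deg≤ → ¬low (lose (spans F∈ v∈F) deg≤)))
      open RigidPairs has-rigid-pair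

      HasSatellite : Fin n → Set
      HasSatellite c = ∃[ a ] ∃[ b ] (a ≢ b × Rigid a b × Satellite a b c)

      has-satellite? : Decidable HasSatellite
      has-satellite? c = anyFin? λ a → anyFin? λ b →
        ¬? (a ≟ b) ×-dec rigid? a b ×-dec satellite? a b c

      branches : 8 * q * length A ≤ rate * length U
      branches with Any.any? has-satellite? U
      ... | yes found =
        let (c , c∈U , a , b , a≢b , ab , sat) = find found
            open Satellites U spans a≢b ab
        -- All satellites of the pair go together; removed singly, they could not use the quadratic
        -- saving of `satellite-cost`.
        in recurse touched? (satellite? a b) (λ {_} {v} _ v∈F v-sat → v , v-sat , v∈F)
          (count-pos (satellite? a b) c∈U sat)
          (satellite-cost (count touched? A) satellites touched-quadratic
            (ℕₚ.≤-trans (ℕₚ.*-monoʳ-≤ (2 * (q * q)) touched≤codeg) (sparse a≢b)))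
      ... | no ¬found = paired-cost (length A) (length U) U≤n
        (Paired.paired-quadratic U spans
          (λ {a} {b} c∈U a≢b ab sat → ¬found (lose c∈U (a , b , a≢b , ab , sat))))

  family-bound : ∀ A → IsIndependentSet A → Sparse A → 8 * q * length A ≤ rate * n
  family-bound A independent sparse = subst (λ m → 8 * q * length A ≤ rate * m) (length-tabulate id)
    (bounded _ (allFin n) A independent (λ {_} {v} _ _ → ∈-allFin v) sparse ℕₚ.≤-refl
      (ℕₚ.≤-reflexive (length-tabulate id)))

-- Transfer to rational numbers and the asymptotic bound.

open import Data.Integer as ℤ using (+_; -[1+_]; +≤+; +<+)
import Data.Integer.Properties as ℤₚ
open import Data.Rational as ℚ
  using (ℚ; mkℚ; 0ℚ; 1ℚ; ½; _<_; _≤_; _+_; _*_; _⊔_; _/_; toℚᵘ; *<*)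
import Data.Rational.Properties as ℚₚ
open import Data.Rational.Unnormalised as ℚᵘ using (mkℚᵘ; *≡*; *≤*)
import Data.Rational.Unnormalised.Properties as ℚᵘₚ
open import Data.Rational.Solver using (module +-*-Solver)
import Relation.Binary.Reasoning.Setoid ℚᵘₚ.≃-setoid as ≃-Reasoning


≤-foldr-⊔ : ∀ {m ms} → m ∈ˡ ms → m Nat.≤ foldr Nat._⊔_ 0 ms
≤-foldr-⊔ (here refl) = ℕₚ.m≤m⊔n _ _
≤-foldr-⊔ (there m∈)  = ℕₚ.≤-trans (≤-foldr-⊔ m∈) (ℕₚ.m≤n⊔m _ _)

≤-grid-maximum : ∀ {n} (f : Fin n → Fin n → List ℕ) m x y → m ∈ˡ f x y →
  m Nat.≤ foldr Nat._⊔_ 0 (concatMap (λ x → concatMap (f x) (allFin n)) (allFin n))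
≤-grid-maximum {n} f m x y m∈ = ≤-foldr-⊔ (∈-concatMap⁺ (λ x → concatMap (f x) (allFin n))
  (lose (∈-allFin x) (∈-concatMap⁺ (f x) (lose (∈-allFin y) m∈))))

module _ {n : ℕ} (A : List (Subset n)) where

  -- Unification recovers the function pairValue that is local to the definition of d.
  pair-values : ∃ λ (f : Fin n → Fin n → List ℕ) → ∀ m x y → m ∈ˡ f x y → m Nat.≤ d A
  pair-values = _ , ≤-grid-maximum _

  pairCount≤d : ∀ {x y} → x ≢ y → pairCount A x y Nat.≤ d A
  -- Abstracting `x ≟ y` in both terms reduces the grid entry at `x`, `y` to a one-element list.
  pairCount≤d {x} {y} x≢y with x ≟ y | proj₂ pair-values (pairCount A x y) x y
  ... | yes x≡y | _ = contradiction x≡y x≢y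
  ... | no _    | h = h (here refl)

-- `_/_` normalises its result, so identities for `ℕtoℚ` are verified on unnormalised fractions with
-- denominator 1.
toℚᵘ-ℕtoℚ : ∀ m → toℚᵘ (ℕtoℚ m) ℚᵘ.≃ mkℚᵘ (+ m) 0
toℚᵘ-ℕtoℚ m = ℚₚ.toℚᵘ-fromℚᵘ (mkℚᵘ (+ m) 0)

ℕtoℚ-* : ∀ a b → ℕtoℚ (a Nat.* b) ≡ ℕtoℚ a * ℕtoℚ b
ℕtoℚ-* a b = ℚₚ.toℚᵘ-injective (begin
  toℚᵘ (ℕtoℚ (a Nat.* b))            ≈⟨ toℚᵘ-ℕtoℚ (a Nat.* b) ⟩
  mkℚᵘ (+ (a Nat.* b)) 0             ≈⟨ *≡* (cong (ℤ._* + 1) (ℤₚ.pos-* a b)) ⟩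
  mkℚᵘ (+ a) 0 ℚᵘ.* mkℚᵘ (+ b) 0     ≈⟨ ℚᵘₚ.*-cong (toℚᵘ-ℕtoℚ a) (toℚᵘ-ℕtoℚ b) ⟨
  toℚᵘ (ℕtoℚ a) ℚᵘ.* toℚᵘ (ℕtoℚ b)   ≈⟨ ℚₚ.toℚᵘ-homo-* (ℕtoℚ a) (ℕtoℚ b) ⟨
  toℚᵘ (ℕtoℚ a * ℕtoℚ b)             ∎)
  where open ≃-Reasoning

ℕtoℚ-+ : ∀ a b → ℕtoℚ (a Nat.+ b) ≡ ℕtoℚ a + ℕtoℚ b
ℕtoℚ-+ a b = ℚₚ.toℚᵘ-injective (begin
  toℚᵘ (ℕtoℚ (a Nat.+ b))            ≈⟨ toℚᵘ-ℕtoℚ (a Nat.+ b) ⟩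
  mkℚᵘ (+ (a Nat.+ b)) 0             ≈⟨ *≡* (cong (ℤ._* + 1)
    (trans (ℤₚ.pos-+ a b) (cong₂ ℤ._+_ (sym (ℤₚ.*-identityʳ (+ a))) (sym (ℤₚ.*-identityʳ (+ b)))))) ⟩
  mkℚᵘ (+ a) 0 ℚᵘ.+ mkℚᵘ (+ b) 0     ≈⟨ ℚᵘₚ.+-cong (toℚᵘ-ℕtoℚ a) (toℚᵘ-ℕtoℚ b) ⟨
  toℚᵘ (ℕtoℚ a) ℚᵘ.+ toℚᵘ (ℕtoℚ b)   ≈⟨ ℚₚ.toℚᵘ-homo-+ (ℕtoℚ a) (ℕtoℚ b) ⟨
  toℚᵘ (ℕtoℚ a + ℕtoℚ b)             ∎)
  where open ≃-Reasoning

ℕtoℚ-mono : ∀ {a b} → a Nat.≤ b → ℕtoℚ a ≤ ℕtoℚ b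
ℕtoℚ-mono {a} {b} a≤b = ℚₚ.toℚᵘ-cancel-≤
  (ℚᵘₚ.≤-respˡ-≃ (ℚᵘₚ.≃-sym (toℚᵘ-ℕtoℚ a)) (ℚᵘₚ.≤-respʳ-≃ (ℚᵘₚ.≃-sym (toℚᵘ-ℕtoℚ b))
    (*≤* (ℤₚ.*-monoʳ-≤-nonNeg (+ 1) (+≤+ a≤b)))))

ℕtoℚ-cancel : ∀ {a b} → ℕtoℚ a ≤ ℕtoℚ b → a Nat.≤ b
ℕtoℚ-cancel {a} {b} h
  with *≤* a≤b ← ℚᵘₚ.≤-respˡ-≃ (toℚᵘ-ℕtoℚ a) (ℚᵘₚ.≤-respʳ-≃ (toℚᵘ-ℕtoℚ b) (ℚₚ.toℚᵘ-mono-≤ h))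
  = ℤₚ.drop‿+≤+ (subst₂ ℤ._≤_ (ℤₚ.*-identityʳ (+ a)) (ℤₚ.*-identityʳ (+ b)) a≤b)

-- The numerator and denominator of `t` itself serve; the denominator is stored minus one, hence
-- `suc q`.
positive-fraction : ∀ t → 0ℚ < t → ∃[ p ] ∃[ q ] (ℕtoℚ (suc q) * t ≡ ℕtoℚ (suc p))
positive-fraction (mkℚ (+ zero) _ _)      (*<* (+<+ ()))
positive-fraction (mkℚ -[1+ _ ] _ _)      (*<* ())
positive-fraction t@(mkℚ (+ suc p) q _) _ = p , q , ℚₚ.toℚᵘ-injective (begin
  toℚᵘ (ℕtoℚ (suc q) * t)                  ≈⟨ ℚₚ.toℚᵘ-homo-* (ℕtoℚ (suc q)) t ⟩
  toℚᵘ (ℕtoℚ (suc q)) ℚᵘ.* mkℚᵘ (+ suc p) q ≈⟨ ℚᵘₚ.*-congʳ (toℚᵘ-ℕtoℚ (suc q)) ⟩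
  mkℚᵘ (+ suc q) 0 ℚᵘ.* mkℚᵘ (+ suc p) q    ≈⟨ *≡* (trans (ℤₚ.*-identityʳ _)
    (trans (ℤₚ.*-comm (+ suc q) (+ suc p)) (cong (λ k → + suc p ℤ.* + suc k) (sym (ℕₚ.+-identityʳ q))))) ⟩
  mkℚᵘ (+ suc p) 0                         ≈⟨ toℚᵘ-ℕtoℚ (suc p) ⟨
  toℚᵘ (ℕtoℚ (suc p))                      ∎)
  where open ≃-Reasoning

-- Multiplication by 2q² clears the denominators, since q t = s.
clear-density : ∀ {t} q s n m → ℕtoℚ q * t ≡ ℕtoℚ s →
  ℕtoℚ m ≤ ½ * ((t * ℕtoℚ n) * (t * ℕtoℚ n)) →
  2 Nat.* (q Nat.* q) Nat.* m Nat.≤ (s Nat.* n) Nat.* (s Nat.* n)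
clear-density {t} q s n m qt≡s m≤ = ℕtoℚ-cancel (begin
  ℕtoℚ (2 Nat.* (q Nat.* q) Nat.* m)        ≡⟨ trans (ℕtoℚ-* (2 Nat.* (q Nat.* q)) m)
      (cong (_* M) (trans (ℕtoℚ-* 2 (q Nat.* q)) (cong (ℕtoℚ 2 *_) (ℕtoℚ-* q q)))) ⟩
  c * M                                     ≤⟨ ℚₚ.*-monoˡ-≤-nonNeg c {{c≥0}} m≤ ⟩
  c * (½ * ((t * N) * (t * N)))             ≡⟨ ring Q t N ⟩
  ((Q * t) * N) * ((Q * t) * N)             ≡⟨ cong (λ z → (z * N) * (z * N)) qt≡s ⟩
  (ℕtoℚ s * N) * (ℕtoℚ s * N)               ≡⟨ cong₂ _*_ (ℕtoℚ-* s n) (ℕtoℚ-* s n) ⟨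
  ℕtoℚ (s Nat.* n) * ℕtoℚ (s Nat.* n)       ≡⟨ ℕtoℚ-* (s Nat.* n) (s Nat.* n) ⟨
  ℕtoℚ ((s Nat.* n) Nat.* (s Nat.* n))      ∎)
  where
  open ℚₚ.≤-Reasoning
  Q N M c : ℚ
  Q = ℕtoℚ q
  N = ℕtoℚ n
  M = ℕtoℚ m
  c = ℕtoℚ 2 * (Q * Q)
  c≥0 : ℚ.NonNegative c
  c≥0 = ℚ.nonNegative (subst (0ℚ ≤_)
    (trans (ℕtoℚ-* 2 (q Nat.* q)) (cong (ℕtoℚ 2 *_) (ℕtoℚ-* q q)))
    (ℕtoℚ-mono {0} {2 Nat.* (q Nat.* q)} z≤n))
  ring : ∀ Q t N → ℕtoℚ 2 * (Q * Q) * (½ * ((t * N) * (t * N))) ≡ ((Q * t) * N) * ((Q * t) * N)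
  ring = solve 3 (λ Q t N →
    con (ℕtoℚ 2) :* (Q :* Q) :* (con ½ :* ((t :* N) :* (t :* N))) := ((Q :* t) :* N) :* ((Q :* t) :* N)) refl
    where open +-*-Solver

sparse-of-d : ∀ {n} (A : List (Subset n)) q s →
  2 Nat.* (suc q Nat.* suc q) Nat.* d A Nat.≤ s Nat.* s → Peeling.Sparse n (suc q) s A
sparse-of-d {n} A q s h {a} {b} a≢b = ℕₚ.≤-trans
  (ℕₚ.*-monoʳ-≤ (2 Nat.* (suc q Nat.* suc q)) (ℕₚ.≤-trans
    (subst (count (Peeling.pair? n (suc q) s a b) A Nat.≤_) (count-filter both? A)
      (count-mono (Peeling.pair? n (suc q) s a b) both? A λ { _ (a∈ ∷ b∈ ∷ []) → a∈ , b∈ }))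
    (pairCount≤d A a≢b)))
  h
  where
  both? : ∀ (F : Subset n) → Dec (a ∈ F × b ∈ F)
  both? F = (a ∈? F) ×-dec (b ∈? F)

-- Division by 8q turns the three parts of `rate`, each times `n`, into n²/8, tn²/2 and 27n.
rate-bound : ∀ {t} q s n l → ℕtoℚ (suc q) * t ≡ ℕtoℚ s →
  8 Nat.* suc q Nat.* l Nat.≤ Peeling.rate n (suc q) (s Nat.* n) Nat.* n →
  ℕtoℚ l ≤ ((ℕtoℚ n * ℕtoℚ n) * (+ 1 / 8)) ⊔ (½ * (t * (ℕtoℚ n * ℕtoℚ n))) + ℕtoℚ 27 * ℕtoℚ n
rate-bound {t} q s n l qt≡s h = ℚₚ.*-cancelˡ-≤-pos c {{c>0}} (begin
  c * L                                       ≡⟨ trans (ℕtoℚ-* (8 Nat.* suc q) l) (cong (_* L) (ℕtoℚ-* 8 (suc q))) ⟨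
  ℕtoℚ (8 Nat.* suc q Nat.* l)                ≤⟨ ℕtoℚ-mono h ⟩
  -- The integer maximum equals one of its arguments, and each of the two is compared with the
  -- rational maximum.
  ℕtoℚ (Peeling.rate n (suc q) (s Nat.* n) Nat.* n) ≤⟨ main (ℕₚ.⊔-sel (suc q Nat.* n) (4 Nat.* (s Nat.* n))) ⟩
  c * (B₁ ⊔ B₂ + ℕtoℚ 27 * N)                   ∎)
  where
  open ℚₚ.≤-Reasoning
  Q N L B₁ B₂ c : ℚ
  Q = ℕtoℚ (suc q)
  N = ℕtoℚ n
  L = ℕtoℚ l
  B₁ = (N * N) * (+ 1 / 8)
  B₂ = ½ * (t * (N * N))
  c = ℕtoℚ 8 * Q
  c>0 : ℚ.Positive c
  c>0 = ℚ.positive (ℚₚ.<-≤-trans {0ℚ} {1ℚ} (ℚₚ.positive⁻¹ 1ℚ)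
    (subst (1ℚ ≤_) (ℕtoℚ-* 8 (suc q)) (ℕtoℚ-mono {1} {8 Nat.* suc q} (s≤s z≤n))))
  push : ∀ Z → Z ≤ B₁ ⊔ B₂ → c * (Z + ℕtoℚ 27 * N) ≤ c * (B₁ ⊔ B₂ + ℕtoℚ 27 * N)
  push Z Z≤ = ℚₚ.*-monoˡ-≤-nonNeg c {{ℚₚ.pos⇒nonNeg c {{c>0}}}} (ℚₚ.+-monoˡ-≤ (ℕtoℚ 27 * N) Z≤)
  expand : ∀ k → ℕtoℚ ((k Nat.+ 216 Nat.* suc q) Nat.* n) ≡ (ℕtoℚ k + ℕtoℚ 216 * Q) * N
  expand k = trans (ℕtoℚ-* (k Nat.+ 216 Nat.* suc q) n) (cong (_* N)
    (trans (ℕtoℚ-+ k (216 Nat.* suc q)) (cong (λ z → ℕtoℚ k + z) (ℕtoℚ-* 216 (suc q)))))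
  ring₁ : ∀ Q N → (Q * N + ℕtoℚ 216 * Q) * N ≡ ℕtoℚ 8 * Q * ((N * N) * (+ 1 / 8) + ℕtoℚ 27 * N)
  ring₁ = solve 2 (λ Q N → (Q :* N :+ con (ℕtoℚ 216) :* Q) :* N :=
    con (ℕtoℚ 8) :* Q :* ((N :* N) :* con (+ 1 / 8) :+ con (ℕtoℚ 27) :* N)) refl
    where open +-*-Solver
  ring₂ : ∀ Q t N → (ℕtoℚ 4 * ((Q * t) * N) + ℕtoℚ 216 * Q) * N ≡
    ℕtoℚ 8 * Q * (½ * (t * (N * N)) + ℕtoℚ 27 * N)
  ring₂ = solve 3 (λ Q t N → (con (ℕtoℚ 4) :* ((Q :* t) :* N) :+ con (ℕtoℚ 216) :* Q) :* N :=
    con (ℕtoℚ 8) :* Q :* (con ½ :* (t :* (N :* N)) :+ con (ℕtoℚ 27) :* N)) refl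
    where open +-*-Solver
  main : ∀ {k} → k ≡ suc q Nat.* n ⊎ k ≡ 4 Nat.* (s Nat.* n) →
    ℕtoℚ ((k Nat.+ 216 Nat.* suc q) Nat.* n) ≤ c * (B₁ ⊔ B₂ + ℕtoℚ 27 * N)
  main (inj₁ refl) = begin
    ℕtoℚ ((suc q Nat.* n Nat.+ 216 Nat.* suc q) Nat.* n) ≡⟨ expand (suc q Nat.* n) ⟩
    (ℕtoℚ (suc q Nat.* n) + ℕtoℚ 216 * Q) * N  ≡⟨ cong (λ z → (z + ℕtoℚ 216 * Q) * N) (ℕtoℚ-* (suc q) n) ⟩
    (Q * N + ℕtoℚ 216 * Q) * N                 ≡⟨ ring₁ Q N ⟩
    c * (B₁ + ℕtoℚ 27 * N)                      ≤⟨ push B₁ (ℚₚ.p≤p⊔q B₁ B₂) ⟩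
    c * (B₁ ⊔ B₂ + ℕtoℚ 27 * N)                  ∎
  main (inj₂ refl) = begin
    ℕtoℚ ((4 Nat.* (s Nat.* n) Nat.+ 216 Nat.* suc q) Nat.* n) ≡⟨ expand (4 Nat.* (s Nat.* n)) ⟩
    (ℕtoℚ (4 Nat.* (s Nat.* n)) + ℕtoℚ 216 * Q) * N
      ≡⟨ cong (λ z → (z + ℕtoℚ 216 * Q) * N) (trans (ℕtoℚ-* 4 (s Nat.* n))
          (cong (ℕtoℚ 4 *_) (trans (ℕtoℚ-* s n) (cong (_* N) (sym qt≡s))))) ⟩
    (ℕtoℚ 4 * ((Q * t) * N) + ℕtoℚ 216 * Q) * N ≡⟨ ring₂ Q t N ⟩
    c * (B₂ + ℕtoℚ 27 * N)                      ≤⟨ push B₂ (ℚₚ.p≤q⊔p B₁ B₂) ⟩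
    c * (B₁ ⊔ B₂ + ℕtoℚ 27 * N)                  ∎

-- The error 27n is 216 times n/8. Once 216 ≤ εn it is at most ε n²/8, hence at most εZ.
absorb-linear : ∀ {ε} e k n → 0ℚ < ε → ℕtoℚ (suc e) * ε ≡ ℕtoℚ (suc k) → 216 Nat.* suc e Nat.≤ n →
  ∀ Z → (ℕtoℚ n * ℕtoℚ n) * (+ 1 / 8) ≤ Z → Z + ℕtoℚ 27 * ℕtoℚ n ≤ (1ℚ + ε) * Z
absorb-linear {ε} e k n 0<ε eε≡k n≥ Z X≤Z = begin
  Z + ℕtoℚ 27 * N                        ≡⟨ cong (λ z → Z + z) (ring₁ N) ⟩
  Z + (N * (+ 1 / 8)) * ℕtoℚ 216         ≤⟨ ℚₚ.+-monoʳ-≤ Z (ℚₚ.*-monoˡ-≤-nonNeg (N * (+ 1 / 8)) {{N/8≥0}} 216≤) ⟩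
  Z + (N * (+ 1 / 8)) * (ε * N)          ≡⟨ cong (λ z → Z + z) (ring₂ N ε) ⟩
  Z + ε * ((N * N) * (+ 1 / 8))          ≤⟨ ℚₚ.+-monoʳ-≤ Z (ℚₚ.*-monoˡ-≤-nonNeg ε {{ε≥0}} X≤Z) ⟩
  Z + ε * Z                              ≡⟨ ring₃ Z ε ⟩
  (1ℚ + ε) * Z                           ∎
  where
  open ℚₚ.≤-Reasoning
  N : ℚ
  N = ℕtoℚ n
  ε≥0 : ℚ.NonNegative ε
  ε≥0 = ℚₚ.pos⇒nonNeg ε {{ℚ.positive 0<ε}}
  N/8≥0 : ℚ.NonNegative (N * (+ 1 / 8))
  N/8≥0 = ℚ.nonNegative (subst (_≤ N * (+ 1 / 8)) (ℚₚ.*-zeroˡ (+ 1 / 8))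
    (ℚₚ.*-monoʳ-≤-nonNeg (+ 1 / 8) (ℕtoℚ-mono {0} {n} z≤n)))
  216≤ : ℕtoℚ 216 ≤ ε * N
  216≤ = begin
    -- The numerator `suc k` of ε is at least 1, so ε is at least the reciprocal of `suc e`.
    ℕtoℚ 216                    ≤⟨ ℕtoℚ-mono (ℕₚ.m≤m*n 216 (suc k)) ⟩
    ℕtoℚ (216 Nat.* suc k)      ≡⟨ trans (ℕtoℚ-* 216 (suc k)) (cong (ℕtoℚ 216 *_) (sym eε≡k)) ⟩
    ℕtoℚ 216 * (ℕtoℚ (suc e) * ε) ≡⟨ ring₄ (ℕtoℚ 216) (ℕtoℚ (suc e)) ε ⟩
    ε * (ℕtoℚ 216 * ℕtoℚ (suc e)) ≡⟨ cong (ε *_) (ℕtoℚ-* 216 (suc e)) ⟨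
    ε * ℕtoℚ (216 Nat.* suc e)  ≤⟨ ℚₚ.*-monoˡ-≤-nonNeg ε {{ε≥0}} (ℕtoℚ-mono n≥) ⟩
    ε * N                       ∎
    where
    ring₄ : ∀ a b c → a * (b * c) ≡ c * (a * b)
    ring₄ = solve 3 (λ a b c → a :* (b :* c) := c :* (a :* b)) refl
      where open +-*-Solver
  ring₁ : ∀ N → ℕtoℚ 27 * N ≡ (N * (+ 1 / 8)) * ℕtoℚ 216
  ring₁ = solve 1 (λ N → con (ℕtoℚ 27) :* N := (N :* con (+ 1 / 8)) :* con (ℕtoℚ 216)) refl
    where open +-*-Solver
  ring₂ : ∀ N ε → (N * (+ 1 / 8)) * (ε * N) ≡ ε * ((N * N) * (+ 1 / 8))
  ring₂ = solve 2 (λ N ε → (N :* con (+ 1 / 8)) :* (ε :* N) := ε :* ((N :* N) :* con (+ 1 / 8))) refl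
    where open +-*-Solver
  ring₃ : ∀ Z ε → Z + ε * Z ≡ (1ℚ + ε) * Z
  ring₃ = solve 2 (λ Z ε → Z :+ ε :* Z := (con 1ℚ :+ ε) :* Z) refl
    where open +-*-Solver

theorem6 : (t : ℚ) → 0ℚ < t → t < 1ℚ →
    (ε : ℚ) → 0ℚ < ε →
    ∃ λ (N : ℕ) → ∀ (n : ℕ) → n ≥ N →
    (A : List (Subset n)) → IsIndependentSet A →
    ℕtoℚ (d A) ≤ ½ * ((t * ℕtoℚ n) * (t * ℕtoℚ n)) →
    ℕtoℚ (length A) ≤ (1ℚ + ε) * (((ℕtoℚ n * ℕtoℚ n) * (+ 1 / 8)) ⊔ (½ * (t * (ℕtoℚ n * ℕtoℚ n))))
theorem6 t 0<t _ ε 0<ε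
  with positive-fraction t 0<t | positive-fraction ε 0<ε
-- The threshold is 216 times the denominator of ε and does not involve `t`; the numerator standing
-- for tn is `suc p * n`, over `suc q`.
... | p , q , qt≡p | k , e , eε≡k = 216 Nat.* suc e , λ n n≥ A independent d≤ →
  let sparse = sparse-of-d A q (suc p Nat.* n) (clear-density (suc q) (suc p) n (d A) qt≡p d≤)
      bound  = Peeling.family-bound n (suc q) (suc p Nat.* n) A independent sparse
  in ℚₚ.≤-trans (rate-bound q (suc p) n (length A) qt≡p bound)
       (absorb-linear e k n 0<ε eε≡k n≥ _ (ℚₚ.p≤p⊔q _ _))
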